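{- Let $\mathfrak U$ be a Grothendieck universe, let $L\in\mathfrak U$ be a first-order language and let $T$ be an $L$-theory. Then the categories $\mathbb{M}\mathrm{od}_{\mathfrak U}(T)$ and $\mathbb{M}\mathrm{od}^{\mathrm{str}}_{\mathfrak U}(T)$ are universal as structures in the language $L_{\mathrm{cat}}$ of categories. That is: if $\mathbb C$ is any small category which is $L_{\mathrm{cat}}$-elementarily equivalent to $\mathbb{M}\mathrm{od}_{\mathfrak U}(T)$ (respectively, to $\mathbb{M}\mathrm{od}^{\mathrm{str}}_{\mathfrak U}(T)$), then there is an embedding of categories $\mathbb C\hookrightarrow \mathbb{M}\mathrm{od}_{\mathfrak U}(T)$ (respectively, $\mathbb C\hookrightarrow\mathbb{M}\mathrm{od}^{\mathrm{str}}_{\mathfrak U}(T)$).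
   Context: A Grothendieck universe is a set $\mathfrak U$ that is transitive, closed under power sets, closed under unions $\bigcup_{i\in I}x_i$ with $I\in\mathfrak U$ and all $x_i\in\mathfrak U$, and contains $\omega$. Fix one. For a first-order language $L\in\mathfrak U$, $D(\mathcal N)$ denotes the underlying set of an $L$-structure $\mathcal N$, and $\mathcal N$ is small if $D(\mathcal N)\in\mathfrak U$. $\mathbb{M}\mathrm{od}_{\mathfrak U}(T)$ is the category whose objects are the small models of $T$ and whose morphisms are all $L$-homomorphisms. $\mathbb{M}\mathrm{od}^{\mathrm{str}}_{\mathfrak U}(T)$ has the same objects, but its morphisms are the strong homomorphisms, i.e. homomorphisms $f$ such that for each relation symbol $R$ a tuple satisfies $R$ if and only if its image under $f$ satisfies $R$. $L_{\mathrm{cat}}$ is the two-sorted language with an object sort and a morphism sort, a binary (partial) function $\circ$ on morphisms (composition), unary functions dom and rng from morphisms to objects, and a unary function Id from objects to morphisms (identity morphism). Composition is regarded as a partial function, defined only on composable pairs (equivalently, one uses its graph as a ternary relation). Every category is an $L_{\mathrm{cat}}$-structure, and elementary equivalence refers to first-order $L_{\mathrm{cat}}$-sentences (with equality). A category is small if both its set of objects and its set of morphisms are elements of $\mathfrak U$. An embedding of categories is a functor that is injective on objects and on morphisms. A structure $\mathcal M$ in a first-order language is universal if $D(\mathcal M)\subseteq\mathfrak U$ and every small structure elementarily equivalent to $\mathcal M$ embeds in $\mathcal M$. -}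

module Defs where

open import Data.Fin.Base using (Fin)
open import Data.Nat.Base using (ℕ; zero; suc)
open import Data.Product.Base using (Σ; Σ-syntax; ∃-syntax; _×_; _,_; proj₁; proj₂)
open import Data.Sum.Base using (_⊎_; [_,_])
open import Data.Vec.Functional using (Vector; []; _∷_)
open import Function.Base using (_∘_; id)
open import Function.Bundles using (_⇔_; mk⇔; Equivalence; Func; _⟨$⟩_)
open import Function.Definitions using (Injective)
open import Level using (Level; Lift; _⊔_) renaming (suc to lsuc)
open import Relation.Binary.Bundles using (Setoid)
open import Relation.Binary.PropositionalEquality.Core using (_≡_)
open import Relation.Nullary.Negation.Core using (¬_)
open import Relation.Unary using (Pred)

open Equivalence using (to; from)

------------------------------------------------------------------------
-- Sets.  The ambient set theory is Aczel's type V of iterative sets; with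
-- excluded middle and choice (hypotheses of the theorem) it satisfies ZFC.

data V (ℓ : Level) : Set (lsuc ℓ) where
  sup : (A : Set ℓ) → (A → V ℓ) → V ℓ

module _ {ℓ : Level} where

  infix 4 _≈_ _∈_ _⊆_ _∼_

  Index : V ℓ → Set ℓ
  Index (sup A f) = A

  -- The members of a set, as a type.  A set may list the same member several
  -- times, so the meaningful equality on El x is _∼_ and not _≡_.
  record El (x : V ℓ) : Set ℓ where
    constructor el
    field index : Index x

  val : {x : V ℓ} → El x → V ℓ
  val {sup A f} (el a) = f a

  _≈_ : V ℓ → V ℓ → Set ℓ
  sup A f ≈ sup B g = (∀ a → ∃[ b ] f a ≈ g b) × (∀ b → ∃[ a ] f a ≈ g b)

  _∼_ : {x y : V ℓ} → El x → El y → Set ℓ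
  a ∼ b = val a ≈ val b

  _∈_ _⊆_ : V ℓ → V ℓ → Set ℓ
  x ∈ y = Σ[ b ∈ El y ] x ≈ val b
  x ⊆ y = (a : El x) → val a ∈ y

  ≈-refl : {x : V ℓ} → x ≈ x
  ≈-refl {sup A f} = (λ a → a , ≈-refl) , (λ a → a , ≈-refl)

  ≈-sym : {x y : V ℓ} → x ≈ y → y ≈ x
  ≈-sym {sup A f} {sup B g} (p , q) =
    (λ b → proj₁ (q b) , ≈-sym (proj₂ (q b))) ,
    (λ a → proj₁ (p a) , ≈-sym (proj₂ (p a)))

  ≈-trans : {x y z : V ℓ} → x ≈ y → y ≈ z → x ≈ z
  ≈-trans {sup A f} {sup B g} {sup C h} (p , q) (r , s) =
    (λ a → let (b , e) = p a ; (c , e′) = r b in c , ≈-trans e e′) ,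
    (λ c → let (b , e′) = s c ; (a , e) = q b in a , ≈-trans e e′)

  ElSetoid : V ℓ → Setoid ℓ ℓ
  ElSetoid x = record
    { Carrier = El x ; _≈_ = _∼_
    ; isEquivalence = record { refl = ≈-refl ; sym = ≈-sym ; trans = ≈-trans } }

  cast : {x y : V ℓ} → x ≈ y → El x → El y
  cast {sup A f} {sup B g} (p , _) (el a) = el (proj₁ (p a))

  cast-∼ : {x y : V ℓ} (e : x ≈ y) (a : El x) → cast e a ∼ a
  cast-∼ {sup A f} {sup B g} (p , _) (el a) = ≈-sym (proj₂ (p a))

  infixr 4 _≈⃗_
  _≈⃗_ : {x y : V ℓ} {n : ℕ} → Vector (El x) n → Vector (El y) n → Set ℓ
  xs ≈⃗ ys = ∀ i → xs i ∼ ys i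

  ∅ : V ℓ
  ∅ = sup (Lift ℓ (Fin 0)) (λ ())

  -- x ∪ {x}
  succ : V ℓ → V ℓ
  succ x = sup (El x ⊎ Lift ℓ (Fin 1)) [ val , (λ _ → x) ]

  numeral : ℕ → V ℓ
  numeral zero    = ∅
  numeral (suc n) = succ (numeral n)

  ω : V ℓ
  ω = sup (Lift ℓ ℕ) (λ n → numeral (Level.lower n))

  record IsGrothendieckUniverse (U : V ℓ) : Set (lsuc ℓ) where
    field
      transitive : ∀ {x y} → x ∈ y → y ∈ U → x ∈ U
      powerset   : ∀ {x} → x ∈ U → ∃[ p ] p ∈ U × (∀ z → z ∈ p ⇔ z ⊆ x)
      -- The family has to respect _∼_ to be a function on the set I.
      unions     : ∀ {I} → I ∈ U → (x : El I → V ℓ) →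
                   (∀ {i j} → i ∼ j → x i ≈ x j) → (∀ i → x i ∈ U) →
                   ∃[ u ] u ∈ U × (∀ z → z ∈ u ⇔ (∃[ i ] z ∈ x i))
      infinity   : ω ∈ U

-- Every equivalence relation has a system of representatives.
AxiomOfChoice : (a b : Level) → Set (lsuc (a ⊔ b))
AxiomOfChoice a b = (S : Setoid a b) → let open Setoid S renaming (_≈_ to _≈ₛ_) in
  Σ[ r ∈ (Carrier → Carrier) ] (∀ x → r x ≈ₛ x) × (∀ {x y} → x ≈ₛ y → r x ≡ r y)

------------------------------------------------------------------------
-- First-order languages, structures and theories

-- Fun n and Rel n are the sets of n-ary function and relation symbols.
record Language (ℓ : Level) : Set (lsuc ℓ) where
  field
    Fun Rel : ℕ → V ℓ

-- A universe contains ω and is closed under countable families, so this says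
-- that L, as a pair of sequences of sets, belongs to U.
_∈ᴸ_ : {ℓ : Level} → Language ℓ → V ℓ → Set ℓ
L ∈ᴸ U = ∀ n → Fun n ∈ U × Rel n ∈ U
  where open Language L

module _ {ℓ : Level} (L : Language ℓ) where
  open Language L

  data Term (m : ℕ) : Set ℓ where
    var : Fin m → Term m
    app : ∀ {n} → El (Fun n) → Vector (Term m) n → Term m

  -- Logic is classical, so the remaining connectives are definable.
  data Formula (m : ℕ) : Set ℓ where
    _≐_  : Term m → Term m → Formula m
    atom : ∀ {n} → El (Rel n) → Vector (Term m) n → Formula m
    neg  : Formula m → Formula m
    _∧_  : Formula m → Formula m → Formula m
    ex   : Formula (suc m) → Formula m

  Theory : Set (lsuc ℓ)
  Theory = Pred (Formula 0) ℓ

  -- The congruence laws make the interpretations functions and relations on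
  -- sets of symbols and tuples, whatever the listing of those sets.  First-order
  -- structures are nonempty by convention.
  record Structure : Set (lsuc ℓ) where
    field
      D        : V ℓ
      nonempty : El D
      fun      : ∀ {n} → El (Fun n) → Vector (El D) n → El D
      rel      : ∀ {n} → El (Rel n) → Vector (El D) n → Set ℓ
      fun-cong : ∀ {n} {s t : El (Fun n)} {xs ys : Vector (El D) n} →
                 s ∼ t → xs ≈⃗ ys → fun s xs ∼ fun t ys
      rel-cong : ∀ {n} {s t : El (Rel n)} {xs ys : Vector (El D) n} →
                 s ∼ t → xs ≈⃗ ys → rel s xs → rel t ys

module _ {ℓ : Level} {L : Language ℓ} where
  open Language L

  module _ (M : Structure L) where
    open Structure M

    eval : ∀ {m} → Vector (El D) m → Term L m → El D
    eval ρ (var i)    = ρ i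
    eval ρ (app s ts) = fun s (λ i → eval ρ (ts i))

    Sat : ∀ {m} → Vector (El D) m → Formula L m → Set ℓ
    Sat ρ (t ≐ u)     = eval ρ t ∼ eval ρ u
    Sat ρ (atom s ts) = rel s (λ i → eval ρ (ts i))
    Sat ρ (neg φ)     = ¬ Sat ρ φ
    Sat ρ (φ ∧ ψ)     = Sat ρ φ × Sat ρ ψ
    Sat ρ (ex φ)      = ∃[ a ] Sat (a ∷ ρ) φ

    _⊨_ : Theory L → Set ℓ
    _⊨_ T = ∀ φ → T φ → Sat [] φ

  -- Equality (not isomorphism) of structures: the underlying sets are equal
  -- as sets, and the symbols have the same interpretations on them.
  infix 4 _≋_
  record _≋_ (M N : Structure L) : Set ℓ where
    private
      module M = Structure M
      module N = Structure N
    field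
      D-eq   : M.D ≈ N.D
      fun-eq : ∀ {n} (s : El (Fun n)) (xs : Vector (El M.D) n) (ys : Vector (El N.D) n) →
               xs ≈⃗ ys → M.fun s xs ∼ N.fun s ys
      rel-eq : ∀ {n} (s : El (Rel n)) (xs : Vector (El M.D) n) (ys : Vector (El N.D) n) →
               xs ≈⃗ ys → M.rel s xs ⇔ N.rel s ys

  open _≋_

  ≋-refl : {M : Structure L} → M ≋ M
  ≋-refl {M} = record
    { D-eq   = ≈-refl
    ; fun-eq = λ s xs ys e → fun-cong ≈-refl e
    ; rel-eq = λ s xs ys e → mk⇔ (rel-cong ≈-refl e) (rel-cong ≈-refl (λ i → ≈-sym (e i)))
    } where open Structure M

  ≋-sym : {M N : Structure L} → M ≋ N → N ≋ M
  ≋-sym p = record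
    { D-eq   = ≈-sym (D-eq p)
    ; fun-eq = λ s xs ys e → ≈-sym (fun-eq p s ys xs (λ i → ≈-sym (e i)))
    ; rel-eq = λ s xs ys e → let q = rel-eq p s ys xs (λ i → ≈-sym (e i)) in mk⇔ (from q) (to q)
    }

  ≋-trans : {M N P : Structure L} → M ≋ N → N ≋ P → M ≋ P
  ≋-trans {M} {N} {P} p q = record
    { D-eq   = ≈-trans (D-eq p) (D-eq q)
    ; fun-eq = λ s xs zs e → ≈-trans (fun-eq p s xs (mid xs) (left xs))
                                     (fun-eq q s (mid xs) zs (right xs zs e))
    ; rel-eq = λ s xs zs e →
        let l = rel-eq p s xs (mid xs) (left xs)
            r = rel-eq q s (mid xs) zs (right xs zs e)
        in mk⇔ (to r ∘ to l) (from l ∘ from r)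
    }
    where
    module M = Structure M
    module N = Structure N
    module P = Structure P
    mid : ∀ {n} → Vector (El M.D) n → Vector (El N.D) n
    mid xs i = cast (D-eq p) (xs i)
    left : ∀ {n} (xs : Vector (El M.D) n) → xs ≈⃗ mid xs
    left xs i = ≈-sym (cast-∼ (D-eq p) (xs i))
    right : ∀ {n} (xs : Vector (El M.D) n) (zs : Vector (El P.D) n) → xs ≈⃗ zs → mid xs ≈⃗ zs
    right xs zs e i = ≈-trans (cast-∼ (D-eq p) (xs i)) (e i)

  record Hom (M N : Structure L) : Set ℓ where
    private
      module M = Structure M
      module N = Structure N
    field
      map      : El M.D → El N.D
      map-cong : ∀ {x y} → x ∼ y → map x ∼ map y
      map-fun  : ∀ {n} (s : El (Fun n)) (xs : Vector (El M.D) n) →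
                 map (M.fun s xs) ∼ N.fun s (map ∘ xs)
      map-rel  : ∀ {n} (s : El (Rel n)) (xs : Vector (El M.D) n) →
                 M.rel s xs → N.rel s (map ∘ xs)

  open Hom

  IsStrong : {M N : Structure L} → Hom M N → Set ℓ
  IsStrong {M} {N} h = ∀ {n} (s : El (Rel n)) (xs : Vector (El (Structure.D M)) n) →
    Structure.rel M s xs ⇔ Structure.rel N s (map h ∘ xs)

  -- The identity map, between equal structures.
  ≋⇒Hom : {M N : Structure L} → M ≋ N → Hom M N
  ≋⇒Hom {M} {N} p = record
    { map      = cast (D-eq p)
    ; map-cong = λ {x} {y} e →
        ≈-trans (cast-∼ (D-eq p) x) (≈-trans e (≈-sym (cast-∼ (D-eq p) y)))
    ; map-fun  = λ s xs → ≈-trans (cast-∼ (D-eq p) _)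
        (fun-eq p s xs _ (λ i → ≈-sym (cast-∼ (D-eq p) (xs i))))
    ; map-rel  = λ s xs → to (rel-eq p s xs _ (λ i → ≈-sym (cast-∼ (D-eq p) (xs i))))
    }

  ≋⇒Hom-strong : {M N : Structure L} (p : M ≋ N) → IsStrong (≋⇒Hom p)
  ≋⇒Hom-strong p s xs = rel-eq p s xs _ (λ i → ≈-sym (cast-∼ (D-eq p) (xs i)))

  idHom : {M : Structure L} → Hom M M
  idHom = record
    { map = id ; map-cong = id ; map-fun = λ s xs → ≈-refl ; map-rel = λ s xs r → r }

  infixr 9 _∘ʰ_
  _∘ʰ_ : {M N P : Structure L} → Hom N P → Hom M N → Hom M P
  g ∘ʰ f = record
    { map      = map g ∘ map f
    ; map-cong = map-cong g ∘ map-cong f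
    ; map-fun  = λ s xs → ≈-trans (map-cong g (map-fun f s xs)) (map-fun g s (map f ∘ xs))
    ; map-rel  = λ s xs → map-rel g s (map f ∘ xs) ∘ map-rel f s xs
    }

  ∘ʰ-strong : {M N P : Structure L} (g : Hom N P) (f : Hom M N) →
              IsStrong g → IsStrong f → IsStrong (g ∘ʰ f)
  ∘ʰ-strong g f q p s xs = mk⇔ (to (q s (map f ∘ xs)) ∘ to (p s xs))
                               (from (p s xs) ∘ from (q s (map f ∘ xs)))

------------------------------------------------------------------------
-- Categories, presented as two-sorted structures with a single collection of
-- morphisms.  Equality of objects and of morphisms is part of the structure.

record Category {o e m e′ : Level} (Ob : Setoid o e) (Mor : Setoid m e′) :
                Set (o ⊔ e ⊔ m ⊔ e′) where
  private
    module O = Setoid Ob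
    module M = Setoid Mor
  field
    dom rng : Func Mor Ob
    Id      : Func Ob Mor
    -- comp g f is g ∘ f
    comp    : (g f : M.Carrier) → dom ⟨$⟩ g O.≈ rng ⟨$⟩ f → M.Carrier
    comp-cong : ∀ {g g′ f f′} p p′ → g M.≈ g′ → f M.≈ f′ → comp g f p M.≈ comp g′ f′ p′
    dom-Id    : ∀ a → dom ⟨$⟩ (Id ⟨$⟩ a) O.≈ a
    rng-Id    : ∀ a → rng ⟨$⟩ (Id ⟨$⟩ a) O.≈ a
    dom-comp  : ∀ g f p → dom ⟨$⟩ (comp g f p) O.≈ dom ⟨$⟩ f
    rng-comp  : ∀ g f p → rng ⟨$⟩ (comp g f p) O.≈ rng ⟨$⟩ g
    identityˡ : ∀ f p → comp (Id ⟨$⟩ (rng ⟨$⟩ f)) f p M.≈ f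
    identityʳ : ∀ f p → comp f (Id ⟨$⟩ (dom ⟨$⟩ f)) p M.≈ f
    assoc     : ∀ h g f p q r s → comp (comp h g p) f q M.≈ comp h (comp g f r) s

  -- The graph of composition.
  Comp : M.Carrier → M.Carrier → M.Carrier → Set (e ⊔ e′)
  Comp g f h = Σ[ p ∈ dom ⟨$⟩ g O.≈ rng ⟨$⟩ f ] comp g f p M.≈ h

record SmallCategory {ℓ : Level} (U : V ℓ) : Set (lsuc ℓ) where
  field
    obs mors : V ℓ
    obs∈U    : obs ∈ U
    mors∈U   : mors ∈ U
    category : Category (ElSetoid obs) (ElSetoid mors)

-- Subcategory with the same objects and the morphisms satisfying P.
module _ {o e m e′ p : Level} {Ob : Setoid o e} {Mor : Setoid m e′} where
  private module M = Setoid Mor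

  restrict : Pred M.Carrier p → Setoid (m ⊔ p) e′
  restrict P = record
    { Carrier = Σ M.Carrier P
    ; _≈_ = λ f g → proj₁ f M.≈ proj₁ g
    ; isEquivalence = record { refl = M.refl ; sym = M.sym ; trans = M.trans } }

  wideSubcategory : (C : Category Ob Mor) (P : Pred M.Carrier p) →
    let open Category C in
    (∀ a → P (Id ⟨$⟩ a)) → (∀ g f q → P g → P f → P (comp g f q)) →
    Category Ob (restrict P)
  wideSubcategory C P P-Id P-comp = record
    { dom       = record { to = λ f → dom ⟨$⟩ proj₁ f ; cong = Func.cong dom }
    ; rng       = record { to = λ f → rng ⟨$⟩ proj₁ f ; cong = Func.cong rng }
    ; Id        = record { to = λ a → Id ⟨$⟩ a , P-Id a ; cong = Func.cong Id }
    ; comp      = λ g f q → comp (proj₁ g) (proj₁ f) q ,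
                            P-comp (proj₁ g) (proj₁ f) q (proj₂ g) (proj₂ f)
    ; comp-cong = comp-cong
    ; dom-Id    = dom-Id
    ; rng-Id    = rng-Id
    ; dom-comp  = λ g f → dom-comp (proj₁ g) (proj₁ f)
    ; rng-comp  = λ g f → rng-comp (proj₁ g) (proj₁ f)
    ; identityˡ = λ f → identityˡ (proj₁ f)
    ; identityʳ = λ f → identityʳ (proj₁ f)
    ; assoc     = λ h g f → assoc (proj₁ h) (proj₁ g) (proj₁ f)
    } where open Category C

------------------------------------------------------------------------
-- The two-sorted language of categories; a formula in context m n has m free
-- object variables and n free morphism variables.  Composition, being partial,
-- enters through its graph.

mutual
  data ObTerm (m n : ℕ) : Set where
    var     : Fin m → ObTerm m n
    dom rng : MorTerm m n → ObTerm m n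

  data MorTerm (m n : ℕ) : Set where
    var : Fin n → MorTerm m n
    Id  : ObTerm m n → MorTerm m n

data CatFormula (m n : ℕ) : Set where
  _≐ᵒ_ : ObTerm m n → ObTerm m n → CatFormula m n
  _≐ᵐ_ : MorTerm m n → MorTerm m n → CatFormula m n
  comp : (g f h : MorTerm m n) → CatFormula m n
  neg  : CatFormula m n → CatFormula m n
  _∧_  : CatFormula m n → CatFormula m n → CatFormula m n
  exᵒ  : CatFormula (suc m) n → CatFormula m n
  exᵐ  : CatFormula m (suc n) → CatFormula m n

module _ {o e m e′ : Level} {Ob : Setoid o e} {Mor : Setoid m e′} (C : Category Ob Mor) where
  private
    module O = Setoid Ob
    module M = Setoid Mor
    module C = Category C

  mutual
    evalᵒ : ∀ {k n} → Vector O.Carrier k → Vector M.Carrier n → ObTerm k n → O.Carrier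
    evalᵒ ρ σ (var i) = ρ i
    evalᵒ ρ σ (dom t) = C.dom ⟨$⟩ evalᵐ ρ σ t
    evalᵒ ρ σ (rng t) = C.rng ⟨$⟩ evalᵐ ρ σ t

    evalᵐ : ∀ {k n} → Vector O.Carrier k → Vector M.Carrier n → MorTerm k n → M.Carrier
    evalᵐ ρ σ (var i) = σ i
    evalᵐ ρ σ (Id t)  = C.Id ⟨$⟩ evalᵒ ρ σ t

  CatSat : ∀ {k n} → Vector O.Carrier k → Vector M.Carrier n → CatFormula k n →
           Set (o ⊔ e ⊔ m ⊔ e′)
  CatSat ρ σ (t ≐ᵒ u)     = Lift (o ⊔ m ⊔ e′) (evalᵒ ρ σ t O.≈ evalᵒ ρ σ u)
  CatSat ρ σ (t ≐ᵐ u)     = Lift (o ⊔ m ⊔ e) (evalᵐ ρ σ t M.≈ evalᵐ ρ σ u)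
  CatSat ρ σ (comp g f h) = Lift (o ⊔ m) (C.Comp (evalᵐ ρ σ g) (evalᵐ ρ σ f) (evalᵐ ρ σ h))
  CatSat ρ σ (neg φ)      = ¬ CatSat ρ σ φ
  CatSat ρ σ (φ ∧ ψ)      = CatSat ρ σ φ × CatSat ρ σ ψ
  CatSat ρ σ (exᵒ φ)      = ∃[ a ] CatSat (a ∷ ρ) σ φ
  CatSat ρ σ (exᵐ φ)      = ∃[ f ] CatSat ρ (f ∷ σ) φ

module _ {o₁ e₁ m₁ e₁′ o₂ e₂ m₂ e₂′ : Level}
         {Ob₁ : Setoid o₁ e₁} {Mor₁ : Setoid m₁ e₁′}
         {Ob₂ : Setoid o₂ e₂} {Mor₂ : Setoid m₂ e₂′} where
  private
    module O₁ = Setoid Ob₁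
    module M₁ = Setoid Mor₁
    module O₂ = Setoid Ob₂
    module M₂ = Setoid Mor₂

  ElementarilyEquivalent : Category Ob₁ Mor₁ → Category Ob₂ Mor₂ →
    Set (o₁ ⊔ e₁ ⊔ m₁ ⊔ e₁′ ⊔ o₂ ⊔ e₂ ⊔ m₂ ⊔ e₂′)
  ElementarilyEquivalent C E = (φ : CatFormula 0 0) → CatSat C [] [] φ ⇔ CatSat E [] [] φ

  record Embedding (C : Category Ob₁ Mor₁) (E : Category Ob₂ Mor₂) :
                   Set (o₁ ⊔ e₁ ⊔ m₁ ⊔ e₁′ ⊔ o₂ ⊔ e₂ ⊔ m₂ ⊔ e₂′) where
    private
      module C = Category C
      module E = Category E
    field
      F₀ : Func Ob₁ Ob₂
      F₁ : Func Mor₁ Mor₂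
      F-dom  : ∀ f → F₀ ⟨$⟩ (C.dom ⟨$⟩ f) O₂.≈ E.dom ⟨$⟩ (F₁ ⟨$⟩ f)
      F-rng  : ∀ f → F₀ ⟨$⟩ (C.rng ⟨$⟩ f) O₂.≈ E.rng ⟨$⟩ (F₁ ⟨$⟩ f)
      F-Id   : ∀ a → F₁ ⟨$⟩ (C.Id ⟨$⟩ a) M₂.≈ E.Id ⟨$⟩ (F₀ ⟨$⟩ a)
      F-comp : ∀ g f p q → F₁ ⟨$⟩ (C.comp g f p) M₂.≈ E.comp (F₁ ⟨$⟩ g) (F₁ ⟨$⟩ f) q
      F₀-injective : Injective O₁._≈_ O₂._≈_ (F₀ ⟨$⟩_)
      F₁-injective : Injective M₁._≈_ M₂._≈_ (F₁ ⟨$⟩_)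

------------------------------------------------------------------------
-- The categories of small models

module _ {ℓ : Level} (U : V ℓ) {L : Language ℓ} (T : Theory L) where

  record SmallModel : Set (lsuc ℓ) where
    field
      structure : Structure L
      small     : Structure.D structure ∈ U
      models    : structure ⊨ T

  open SmallModel

  record ModelMorphism : Set (lsuc ℓ) where
    field
      source target : SmallModel
      hom : Hom (structure source) (structure target)

  open ModelMorphism
  open Hom

  SmallModels : Setoid (lsuc ℓ) ℓ
  SmallModels = record
    { Carrier = SmallModel
    ; _≈_ = λ M N → structure M ≋ structure N
    ; isEquivalence = record { refl = ≋-refl ; sym = ≋-sym ; trans = ≋-trans } }

  record _≈ᵐ_ (f g : ModelMorphism) : Set ℓ where
    field
      source-eq : structure (source f) ≋ structure (source g)
      target-eq : structure (target f) ≋ structure (target g)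
      map-eq    : ∀ x y → x ∼ y → map (hom f) x ∼ map (hom g) y

  open _≈ᵐ_
  open _≋_

  ModelMorphisms : Setoid (lsuc ℓ) ℓ
  ModelMorphisms = record
    { Carrier = ModelMorphism
    ; _≈_ = _≈ᵐ_
    ; isEquivalence = record
      { refl  = λ {f} → record
        { source-eq = ≋-refl ; target-eq = ≋-refl ; map-eq = λ x y → map-cong (hom f) }
      ; sym   = λ p → record
        { source-eq = ≋-sym (source-eq p) ; target-eq = ≋-sym (target-eq p)
        ; map-eq = λ x y e → ≈-sym (map-eq p y x (≈-sym e)) }
      ; trans = λ p q → record
        { source-eq = ≋-trans (source-eq p) (source-eq q)
        ; target-eq = ≋-trans (target-eq p) (target-eq q)
        ; map-eq = λ x z e → let d = D-eq (source-eq p) in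
            ≈-trans (map-eq p x (cast d x) (≈-sym (cast-∼ d x)))
                    (map-eq q (cast d x) z (≈-trans (cast-∼ d x) e)) }
      } }

  Mod : Category SmallModels ModelMorphisms
  Mod = record
    { dom = record { to = source ; cong = source-eq }
    ; rng = record { to = target ; cong = target-eq }
    ; Id  = record
      { to   = λ M → record { source = M ; target = M ; hom = idHom }
      ; cong = λ p → record { source-eq = p ; target-eq = p ; map-eq = λ x y e → e } }
    ; comp = λ g f p → record
      { source = source f ; target = target g
      ; hom = hom g ∘ʰ ≋⇒Hom (≋-sym p) ∘ʰ hom f }
    ; comp-cong = λ {g} {g′} {f} {f′} p p′ g≈ f≈ → record
      { source-eq = source-eq f≈ ; target-eq = target-eq g≈
      ; map-eq = λ x y e → map-eq g≈ _ _
          (≈-trans (cast-∼ (D-eq (≋-sym p)) _)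
          (≈-trans (map-eq f≈ x y e) (≈-sym (cast-∼ (D-eq (≋-sym p′)) _)))) }
    ; dom-Id   = λ M → ≋-refl
    ; rng-Id   = λ M → ≋-refl
    ; dom-comp = λ g f p → ≋-refl
    ; rng-comp = λ g f p → ≋-refl
    ; identityˡ = λ f p → record
      { source-eq = ≋-refl ; target-eq = ≋-refl
      ; map-eq = λ x y e → ≈-trans (cast-∼ (D-eq (≋-sym p)) _) (map-cong (hom f) e) }
    ; identityʳ = λ f p → record
      { source-eq = ≋-refl ; target-eq = ≋-refl
      ; map-eq = λ x y e → map-cong (hom f) (≈-trans (cast-∼ (D-eq (≋-sym p)) x) e) }
    ; assoc = λ h g f p q r s → record
      { source-eq = ≋-refl ; target-eq = ≋-refl
      ; map-eq = λ x y e → map-cong (hom h)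
          (map-cong (≋⇒Hom (≋-sym p))
             (map-cong (hom g) (map-cong (≋⇒Hom (≋-sym q)) (map-cong (hom f) e)))
           ⨾ cast-irr (D-eq (≋-sym p)) (D-eq (≋-sym s)) _
           ⨾ map-cong (≋⇒Hom (≋-sym s)) (map-cong (hom g)
               (cast-irr (D-eq (≋-sym q)) (D-eq (≋-sym r)) _))) }
    }
    where
    infixr 5 _⨾_
    _⨾_ : {x y z : V ℓ} → x ≈ y → y ≈ z → x ≈ z
    _⨾_ = ≈-trans
    cast-irr : {x y : V ℓ} (p q : x ≈ y) (a : El x) → cast p a ∼ cast q a
    cast-irr p q a = ≈-trans (cast-∼ p a) (≈-sym (cast-∼ q a))

  IsStrongMorphism : Pred ModelMorphism ℓ
  IsStrongMorphism f = IsStrong (hom f)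

  ModStr : Category SmallModels (restrict {Ob = SmallModels} IsStrongMorphism)
  ModStr = wideSubcategory Mod IsStrongMorphism
    (λ M s xs → mk⇔ id id)
    (λ g f p g-strong f-strong →
      ∘ʰ-strong (hom g) (≋⇒Hom (≋-sym p) ∘ʰ hom f) g-strong
        (∘ʰ-strong (≋⇒Hom (≋-sym p)) (hom f) (≋⇒Hom-strong (≋-sym p)) f-strong))

{-# OPTIONS --safe #-}
module Submission where

-- If ℂ is elementarily equivalent to the category of small models, every finite piece of its
-- diagram is realised there, so ℂ embeds in an ultrapower of that category over the set of finite
-- sets of morphisms of ℂ.  By Łoś's theorem an ultraproduct of small models is a small model; an
-- ultraproduct of homomorphisms is again a (strong) homomorphism, and two sequences of homomorphisms
-- that differ on a large set of indices have different ultraproducts.  So the ultraproduct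
-- construction is faithful on the ultrapower, and tagging elements by the objects of ℂ makes it
-- injective on objects.

open import Defs
open import Axiom.ExcludedMiddle using (ExcludedMiddle)
open import Data.Bool.Base using (Bool; true; false; if_then_else_; not; _∨_) renaming (_∧_ to _&&_)
open import Data.Fin.Base using (Fin; zero; suc)
open import Data.List.Base using (List; []; _∷_; _++_; length)
open import Data.List.Membership.Propositional using () renaming (_∈_ to _∈ˡ_)
open import Data.List.Relation.Binary.Subset.Propositional using () renaming (_⊆_ to _⊆ˡ_)
open import Data.List.Relation.Unary.All as All using (All; []; _∷_)
open import Data.List.Relation.Unary.All.Properties using (++⁺; ++⁻)
open import Data.List.Relation.Unary.Any using (here; there)
open import Data.Nat.Base using (ℕ)
open import Data.Product.Base using (Σ; Σ-syntax; _×_; _,_; proj₁; proj₂)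
open import Data.Sum.Base using (_⊎_; inj₁; inj₂)
open import Data.Vec.Functional using (Vector) renaming ([] to []ᵛ; _∷_ to _∷ᵛ_)
open import Function.Bundles using (Equivalence; Func; _⟨$⟩_; _⇔_; mk⇔)
open import Level using (Level; Lift; lift; lower; _⊔_)
open import Relation.Binary.Bundles using (Setoid)
open import Relation.Binary.PropositionalEquality using (_≡_; refl; sym; trans; cong; subst)
open import Relation.Nullary using (¬_; Dec; yes; no; does; contradiction)
open import Relation.Nullary.Decidable using (decidable-stable)

open Equivalence using (to; from)

-- Ultrafilters

-- Equality in these categories is equality of sets, not isomorphism, and this shapes the
-- construction. Equal objects must go to equal structures, so classes are replaced by chosen
-- representatives throughout. Smallness does not come from Łoś's theorem: it needs indices with
-- distinct names in a member of `U`, and finite subsets of the morphism set have them as elements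
-- of its power set. An element of an ultraproduct is then coded by the graph of a chosen sequence,
-- and all these graphs lie in one member of `U`. Finally, realisations at different indices are
-- chosen independently, so a realised morphism has the expected endpoints only at almost every
-- index; its image is therefore assembled from bare maps that are homomorphisms almost everywhere.

module Classical (em : ∀ {a} → ExcludedMiddle a) where

  holds : ∀ {p} → Set p → Bool
  holds P = does (em {P = P})

  holds⁻ : ∀ {p} {P : Set p} → holds P ≡ true → P
  holds⁻ {P = P} e with em {P = P}
  ... | yes p = p
  holds⁻ () | no _

  holds⁺ : ∀ {p} {P : Set p} → P → holds P ≡ true
  holds⁺ {P = P} p with em {P = P}
  ... | yes _ = refl
  ... | no ¬p = contradiction p ¬p

  by-contradiction : ∀ {p} {P : Set p} → ¬ ¬ P → P
  by-contradiction = decidable-stable em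

  counterexample : ∀ {a p} {A : Set a} {P : A → Set p} → ¬ (∀ x → P x) → Σ[ x ∈ A ] ¬ P x
  counterexample ¬all = by-contradiction λ none →
    ¬all (λ x → by-contradiction λ ¬px → none (x , ¬px))

-- The maximal family is the top of the least tower of families closed under one-point
-- extensions and unions; towers are chains (Bourbaki–Witt).  Families are Bool-valued
-- so that unions over all subsets of the tower stay in the same universe level.
module Tukey (em : ∀ {a} → ExcludedMiddle a) (ac : ∀ {a b} → AxiomOfChoice a b)
  {ℓ : Level} {X : Set ℓ} (P : List X → Set ℓ) (P-[] : P [])
  (P-⊆ : ∀ {k l} → k ⊆ˡ l → P l → P k) where

  open Classical em

  Family : Set ℓ
  Family = X → Bool

  _⊑_ : Family → Family → Set ℓ
  F ⊑ G = ∀ x → F x ≡ true → G x ≡ true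

  Extensional : Setoid ℓ ℓ
  Extensional = record
    { Carrier = Family
    ; _≈_ = λ F G → F ⊑ G × G ⊑ F
    ; isEquivalence = record
      { refl  = (λ _ e → e) , (λ _ e → e)
      ; sym   = λ (p , q) → q , p
      ; trans = λ (p , q) (p′ , q′) → (λ x e → p′ x (p x e)) , (λ x e → q x (q′ x e)) } }

  _⊑⊒_ : Family → Family → Set ℓ
  _⊑⊒_ = Setoid._≈_ Extensional

  canonical : Family → Family
  canonical = proj₁ (ac Extensional)

  canonical-⊑⊒ : ∀ F → canonical F ⊑⊒ F
  canonical-⊑⊒ = proj₁ (proj₂ (ac Extensional))

  canonical-cong : ∀ {F G} → F ⊑⊒ G → canonical F ≡ canonical G
  canonical-cong = proj₂ (proj₂ (ac Extensional))

  Consistent : Family → Set ℓ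
  Consistent F = ∀ l → All (λ x → F x ≡ true) l → P l

  insert : Family → X → Family
  insert F x y = F y ∨ holds (y ≡ x)

  ⊑-insert : ∀ F x → F ⊑ insert F x
  ⊑-insert F x y e rewrite e = refl

  insert-new : ∀ F x → insert F x x ≡ true
  insert-new F x with F x
  ... | true  = refl
  ... | false = holds⁺ refl

  insert⁻ : ∀ F x y → insert F x y ≡ true → F y ≡ true ⊎ y ≡ x
  insert⁻ F x y e with F y
  ... | true  = inj₁ refl
  ... | false = inj₂ (holds⁻ e)

  Addable : Family → X → Set ℓ
  Addable F x = ¬ F x ≡ true × Consistent (insert F x)

  extend : (F : Family) → Dec (Σ X (Addable F)) → Family
  extend F (yes (x , _)) = insert F x
  extend F (no _)        = F

  -- Which point `extend` adds may depend on the presentation of the family. Passing to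
  -- `canonical F` first gives equal families equal successors, as the chain argument needs whenever
  -- two families contain each other.
  next : Family → Family
  next F = extend (canonical F) em

  next-cong : ∀ {F G} → F ⊑⊒ G → next F ⊑ next G
  next-cong F≈G x = subst (λ H → extend H em x ≡ true) (canonical-cong F≈G)

  ⊑-next : ∀ F → F ⊑ next F
  ⊑-next F x e with em {P = Σ X (Addable (canonical F))}
  ... | yes (y , _) = ⊑-insert (canonical F) y x (proj₂ (canonical-⊑⊒ F) x e)
  ... | no _        = proj₂ (canonical-⊑⊒ F) x e

  next-consistent : ∀ F → Consistent F → Consistent (next F)
  next-consistent F c with em {P = Σ X (Addable (canonical F))}
  ... | yes (_ , _ , c′) = c′
  ... | no _             = λ l a → c l (All.map (λ {x} → proj₁ (canonical-⊑⊒ F) x) a)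

  ⋃ : (Family → Bool) → Family
  ⋃ S x = holds (Σ[ F ∈ Family ] S F ≡ true × F x ≡ true)

  ⊑-⋃ : ∀ S {F} → S F ≡ true → F ⊑ ⋃ S
  ⊑-⋃ S s x e = holds⁺ (_ , s , e)

  ⋃-⊑ : ∀ S {G} → (∀ F → S F ≡ true → F ⊑ G) → ⋃ S ⊑ G
  ⋃-⊑ S h x e = let (F , s , e′) = holds⁻ e in h F s x e′

  -- The empty family, from which the tower grows, is `union` over an empty `S`.
  data Tower : Family → Set ℓ where
    step  : ∀ {F} → Tower F → Tower (next F)
    union : ∀ S → (∀ F → S F ≡ true → Tower F) → Tower (⋃ S)

  Extreme : Family → Set ℓ
  Extreme C = ∀ F → Tower F → F ⊑ C → ¬ C ⊑ F → next F ⊑ C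

  extreme-comparable : ∀ {C} → Extreme C → ∀ {F} → Tower F → F ⊑ C ⊎ next C ⊑ F
  extreme-comparable {C} ext (step {F} t) with extreme-comparable ext t
  ... | inj₂ C′⊑F = inj₂ λ x e → ⊑-next F x (C′⊑F x e)
  ... | inj₁ F⊑C with em {P = C ⊑ F}
  ...   | yes C⊑F = inj₂ (next-cong (C⊑F , F⊑C))
  ...   | no C⋢F  = inj₁ (ext F t F⊑C C⋢F)
  extreme-comparable {C} ext (union S t) with em {P = ∀ F → S F ≡ true → F ⊑ C}
  ... | yes below = inj₁ (⋃-⊑ S below)
  ... | no ¬below with counterexample ¬below
  ...   | F , ¬b with em {P = S F ≡ true}
  ...     | no ¬s = contradiction (λ s → contradiction s ¬s) ¬b
  ...     | yes s with extreme-comparable ext (t F s)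
  ...       | inj₁ F⊑C  = contradiction (λ _ → F⊑C) ¬b
  ...       | inj₂ C′⊑F = inj₂ λ x e → ⊑-⋃ S s x (C′⊑F x e)

  tower-extreme : ∀ {C} → Tower C → Extreme C
  tower-extreme (step {C} c) F t F⊑C′ C′⋢F with extreme-comparable (tower-extreme c) t
  ... | inj₂ C′⊑F = contradiction C′⊑F C′⋢F
  ... | inj₁ F⊑C with em {P = C ⊑ F}
  ...   | yes C⊑F = next-cong (F⊑C , C⊑F)
  ...   | no C⋢F  = λ x e → ⊑-next C x (tower-extreme c F t F⊑C C⋢F x e)
  tower-extreme (union S c) F t F⊑⋃ ⋃⋢F
    with em {P = Σ[ D ∈ Family ] Σ[ s ∈ S D ≡ true ] F ⊑ D}
  ... | no none = contradiction (⋃-⊑ S below) ⋃⋢F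
    where
    below : ∀ D → S D ≡ true → D ⊑ F
    below D s with extreme-comparable (tower-extreme (c D s)) t
    ... | inj₁ F⊑D  = contradiction (D , s , F⊑D) none
    ... | inj₂ D′⊑F = λ x e → D′⊑F x (⊑-next D x e)
  ... | yes (D , s , F⊑D) with em {P = D ⊑ F}
  ...   | no D⋢F = λ x e → ⊑-⋃ S s x (tower-extreme (c D s) F t F⊑D D⋢F x e)
  -- Now `F` and `D` coincide and extremeness of `D` is silent, so the union itself is compared with
  -- `D`.
  ...   | yes D⊑F with extreme-comparable (tower-extreme (c D s)) (union S c)
  ...     | inj₁ ⋃⊑D  = contradiction (λ x e → D⊑F x (⋃⊑D x e)) ⋃⋢F
  ...     | inj₂ D′⊑⋃ = λ x e → D′⊑⋃ x (next-cong (F⊑D , D⊑F) x e)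

  tower-chain : ∀ {F G} → Tower F → Tower G → F ⊑ G ⊎ G ⊑ F
  tower-chain {F} {G} s t with extreme-comparable (tower-extreme t) s
  ... | inj₁ F⊑G  = inj₁ F⊑G
  ... | inj₂ G′⊑F = inj₂ λ x e → G′⊑F x (⊑-next G x e)

  tower-consistent : ∀ {F} → Tower F → Consistent F
  tower-consistent (step t) = next-consistent _ (tower-consistent t)
  tower-consistent (union S t) []       _        = P-[]
  tower-consistent (union S t) (x ∷ xs) (a ∷ as) =
    let (F , s , c) = common x xs a as in tower-consistent (t F s) (x ∷ xs) c
    where
    common : ∀ x xs → ⋃ S x ≡ true → All (λ y → ⋃ S y ≡ true) xs →
             Σ[ F ∈ Family ] Σ[ s ∈ S F ≡ true ] All (λ y → F y ≡ true) (x ∷ xs)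
    common x [] a [] = let (F , s , e) = holds⁻ a in F , s , e ∷ []
    common x (y ∷ ys) a (b ∷ bs)
      with holds⁻ a | common y ys b bs
    ... | F , s , e | G , s′ , es with tower-chain (t F s) (t G s′)
    ...   | inj₁ F⊑G = G , s′ , F⊑G x e ∷ es
    ...   | inj₂ G⊑F = F , s , e ∷ All.map (λ {z} → G⊑F z) es

  maximal : Family
  maximal = ⋃ (λ F → holds (Tower F))

  maximal-tower : Tower maximal
  maximal-tower = union _ (λ F → holds⁻)

  maximal-consistent : Consistent maximal
  maximal-consistent = tower-consistent maximal-tower

  maximal-next : next maximal ⊑ maximal
  maximal-next = ⊑-⋃ _ (holds⁺ (step maximal-tower))

  maximal-unaddable : ∀ x → ¬ Addable (canonical maximal) x
  maximal-unaddable x a = absurd (λ y e → proj₂ (canonical-⊑⊒ maximal) y (maximal-next y e))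
    where
    absurd : ¬ next maximal ⊑ canonical maximal
    absurd with em {P = Σ X (Addable (canonical maximal))}
    -- The point `y` added by `next` may differ from `x`; any new point refutes the inclusion.
    ... | yes (y , y∉ , _) = λ h → y∉ (h y (insert-new (canonical maximal) y))
    ... | no none          = λ _ → none (x , a)

  insert-second : ∀ {x y z : X} {l} → z ∈ˡ (x ∷ l) → z ∈ˡ (x ∷ y ∷ l)
  insert-second (here e)  = here e
  insert-second (there m) = there (there m)

  split-insert : ∀ F x l → All (λ y → insert F x y ≡ true) l →
                 Σ[ k ∈ List X ] All (λ y → F y ≡ true) k × l ⊆ˡ (x ∷ k)
  split-insert F x []      []       = [] , [] , λ ()
  split-insert F x (y ∷ l) (a ∷ as) with split-insert F x l as | insert⁻ F x y a
  ... | k , all , l⊆ | inj₁ e    = y ∷ k , e ∷ all , λ where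
    (here refl) → there (here refl)
    (there m)   → insert-second (l⊆ m)
  ... | k , all , l⊆ | inj₂ refl = k , all , λ where
    (here refl) → here refl
    (there m)   → l⊆ m

  -- If `x` were missing it would be addable: a finite part of the enlarged family sits inside `x`
  -- together with a finite part of the old one, and `P` passes to sublists.
  maximal-complete : ∀ x → (∀ l → All (λ y → maximal y ≡ true) l → P (x ∷ l)) →
                     maximal x ≡ true
  maximal-complete x h = by-contradiction λ x∉ → maximal-unaddable x
    ( (λ e → x∉ (proj₁ (canonical-⊑⊒ maximal) x e))
    , λ l a → let (k , all , l⊆) = split-insert (canonical maximal) x l a in
        P-⊆ l⊆ (h k (All.map (λ {y} → proj₁ (canonical-⊑⊒ maximal) y) all)) )

-- Ultrafilters containing the cones of a directed relation

record Ultrafilter {ℓ : Level} (I : Set ℓ) : Set ℓ where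
  field
    member     : (I → Bool) → Bool
    upward     : ∀ {A B} → (∀ i → A i ≡ true → B i ≡ true) →
                 member A ≡ true → member B ≡ true
    intersect  : ∀ {A B} → member A ≡ true → member B ≡ true →
                 member (λ i → A i && B i) ≡ true
    complement : ∀ {A} → ¬ member A ≡ true → member (λ i → not (A i)) ≡ true
    inhabited  : ∀ {A} → member A ≡ true → Σ[ i ∈ I ] A i ≡ true

not-true : ∀ {b} → not b ≡ true → ¬ b ≡ true
not-true {false} _ ()

∧-true : ∀ {b c} → b ≡ true → c ≡ true → b && c ≡ true
∧-true refl refl = refl

module ConeUltrafilter (em : ∀ {a} → ExcludedMiddle a) (ac : ∀ {a b} → AxiomOfChoice a b)
  {ℓ : Level} {I S : Set ℓ} (R : S → I → Set ℓ)
  (directed : (k : List S) → Σ[ i ∈ I ] All (λ s → R s i) k) where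

  open Classical em

  -- The finite intersection property relative to the cones of indices above each `s`. Building the
  -- cones into consistency forces them into every maximal family.
  Meets : List (I → Bool) → Set ℓ
  Meets l = (k : List S) → Σ[ i ∈ I ] All (λ s → R s i) k × All (λ A → A i ≡ true) l

  meets-⊆ : ∀ {k l} → k ⊆ˡ l → Meets l → Meets k
  meets-⊆ k⊆l h s = let (i , r , a) = h s in
    i , r , All.tabulate (λ m → All.lookup a (k⊆l m))

  meets-[] : Meets []
  meets-[] k = let (i , r) = directed k in i , r , []

  open Tukey em ac Meets meets-[] meets-⊆

  -- An index common to `l` and any further finite data also lies in `B`, so `B` is consistent with
  -- the family. Upward closure and binary intersection are both instances.
  maximal-closed : ∀ {l B} → All (λ A → maximal A ≡ true) l →
    (∀ i → All (λ A → A i ≡ true) l → B i ≡ true) → maximal B ≡ true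
  maximal-closed {l} a h = maximal-complete _ λ k b s →
    let (i , r , c) = maximal-consistent (l ++ k) (++⁺ a b) s
        (c₁ , c₂) = ++⁻ l c
    in i , r , h i c₁ ∷ c₂

  ultrafilter : Ultrafilter I
  ultrafilter = record
    { member     = maximal
    ; upward     = λ A⊑B a → maximal-closed (a ∷ []) λ { i (e ∷ []) → A⊑B i e }
    ; intersect  = λ a b → maximal-closed (a ∷ b ∷ []) λ { i (e ∷ e′ ∷ []) → ∧-true e e′ }
    ; complement = complement
    ; inhabited  = λ a → let (i , _ , c) = maximal-consistent _ (a ∷ []) [] in i , All.head c
    }
    where
    complement : ∀ {A} → ¬ maximal A ≡ true → maximal (λ i → not (A i)) ≡ true
    complement {A} ¬a with counterexample (λ h → ¬a (maximal-complete A h))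
    ... | l , ¬h with em {P = All (λ B → maximal B ≡ true) l}
    ...   | no ¬all = contradiction (λ all → contradiction all ¬all) ¬h
    ...   | yes all with counterexample (λ h → ¬h (λ _ → h))
    -- No index in `A` satisfies both `l` and `k`. Consistency gives an index satisfying them along
    -- with `l′` and `k′`, and it must lie outside `A`.
    ...     | k , none = maximal-complete _ λ l′ all′ k′ →
      let (i , r , c) = maximal-consistent (l ++ l′) (++⁺ all all′) (k ++ k′)
          (r₁ , r₂) = ++⁻ k r
          (c₁ , c₂) = ++⁻ l c
      in i , r₂ , false⇒not (λ e → none (i , r₁ , e ∷ c₁)) ∷ c₂
      where
      false⇒not : ∀ {b} → ¬ b ≡ true → not b ≡ true
      false⇒not {false} _ = refl
      false⇒not {true}  h = contradiction refl h

  -- Consistency already tests against every finite list of cones, so the cone of `s` can be moved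
  -- into that list.
  cone : ∀ s → maximal (λ i → holds (R s i)) ≡ true
  cone s = maximal-complete _ λ l all k →
    let (i , r , c) = maximal-consistent l all (s ∷ k)
    in i , All.tail r , holds⁺ (All.head r) ∷ c

module Largeness (em : ∀ {a} → ExcludedMiddle a) {ℓ : Level} {I : Set ℓ}
  (𝓕 : Ultrafilter I) where

  open Classical em
  open Ultrafilter 𝓕

  record Large {p} (P : I → Set p) : Set ℓ where
    constructor large
    field large⁻ : member (λ i → holds (P i)) ≡ true

  open Large

  module _ {p} {P : I → Set p} where

    map : ∀ {q} {Q : I → Set q} → (∀ i → P i → Q i) → Large P → Large Q
    map h (large e) = large (upward (λ i a → holds⁺ (h i (holds⁻ a))) e)

    zip : ∀ {q r} {Q : I → Set q} {R : I → Set r} →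
          (∀ i → P i → Q i → R i) → Large P → Large Q → Large R
    zip {Q = Q} h (large e) (large e′) =
      large (upward (λ i a → let (x , y) = ∧⁻ a in holds⁺ (h i (holds⁻ x) (holds⁻ y)))
                    (intersect e e′))
      where
      ∧⁻ : ∀ {b c} → b && c ≡ true → b ≡ true × c ≡ true
      ∧⁻ {true} e = refl , e

    large-¬ : ¬ Large P → Large (λ i → ¬ P i)
    large-¬ h = large (upward (λ i e → holds⁺ (λ p → not-true e (holds⁺ p)))
                              (complement (λ e → h (large e))))

    witness : Large P → Σ I P
    witness (large e) = let (i , h) = inhabited e in i , holds⁻ h

  -- Otherwise the complement, which is empty, would be large, against `inhabited`.
  always : ∀ {p} {P : I → Set p} → (∀ i → P i) → Large P
  always h = by-contradiction λ ¬l → let (i , ¬p) = witness (large-¬ ¬l) in ¬p (h i)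

  large-∀Fin : ∀ {p n} {P : Fin n → I → Set p} →
               (∀ k → Large (P k)) → Large (λ i → ∀ k → P k i)
  large-∀Fin {n = ℕ.zero}  h = always (λ _ ())
  large-∀Fin {n = ℕ.suc n} h = zip (λ { i a b zero → a ; i a b (suc k) → b k })
    (h zero) (large-∀Fin (λ k → h (suc k)))

-- Sets in a universe

module _ {ℓ : Level} where

  ≡⇒≈ : {x y : V ℓ} → x ≡ y → x ≈ y
  ≡⇒≈ refl = ≈-refl

  val-∈ : {x : V ℓ} (a : El x) → val a ∈ x
  val-∈ a = a , ≈-refl

  ∈-respˡ : {x x′ y : V ℓ} → x ≈ x′ → x ∈ y → x′ ∈ y
  ∈-respˡ e (b , e′) = b , ≈-trans (≈-sym e) e′

  ∈-respʳ : {x y y′ : V ℓ} → y ≈ y′ → x ∈ y → x ∈ y′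
  ∈-respʳ e (b , e′) = cast e b , ≈-trans e′ (≈-sym (cast-∼ e b))

  ∈-image : {A : Set ℓ} (f : A → V ℓ) (a : A) → f a ∈ sup A f
  ∈-image f a = el a , ≈-refl

  ｛_,_｝ : V ℓ → V ℓ → V ℓ
  ｛ x , y ｝ = sup (Lift ℓ Bool) λ b → if lower b then x else y

  ∈-｛｝ˡ : ∀ x y → x ∈ ｛ x , y ｝
  ∈-｛｝ˡ x y = el (lift true) , ≈-refl

  ∈-｛｝ʳ : ∀ x y → y ∈ ｛ x , y ｝
  ∈-｛｝ʳ x y = el (lift false) , ≈-refl

  ∈-｛｝⁻ : ∀ {z x y} → z ∈ ｛ x , y ｝ → z ≈ x ⊎ z ≈ y
  ∈-｛｝⁻ (el (lift true)  , e) = inj₁ e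
  ∈-｛｝⁻ (el (lift false) , e) = inj₂ e

  ｛｝-⊆ : ∀ {x y z} → x ∈ z → y ∈ z → ｛ x , y ｝ ⊆ z
  ｛｝-⊆ p q (el (lift true))  = p
  ｛｝-⊆ p q (el (lift false)) = q

  ⟪_,_⟫ : V ℓ → V ℓ → V ℓ
  ⟪ x , y ⟫ = ｛ ｛ x , x ｝ , ｛ x , y ｝ ｝

  ⟪⟫-injectiveˡ : ∀ {x x′ y y′} → ⟪ x , y ⟫ ≈ ⟪ x′ , y′ ⟫ → x ≈ x′
  ⟪⟫-injectiveˡ {x} {x′} {y} {y′} e with ∈-｛｝⁻ (∈-respʳ e (∈-｛｝ˡ _ _))
  ... | inj₁ e′ with ∈-｛｝⁻ (∈-respʳ e′ (∈-｛｝ˡ x x))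
  ...   | inj₁ h = h
  ...   | inj₂ h = h
  ⟪⟫-injectiveˡ {x} {x′} {y} {y′} e | inj₂ e′ with ∈-｛｝⁻ (∈-respʳ (≈-sym e′) (∈-｛｝ˡ x′ y′))
  ...   | inj₁ h = ≈-sym h
  ...   | inj₂ h = ≈-sym h

  private
    second : ∀ {x x′ y y′} → ⟪ x , y ⟫ ≈ ⟪ x′ , y′ ⟫ → y ≈ x′ ⊎ y ≈ y′
    second {x} {x′} {y} {y′} e with ∈-｛｝⁻ (∈-respʳ e (∈-｛｝ʳ _ _))
    ... | inj₂ e′ = ∈-｛｝⁻ (∈-respʳ e′ (∈-｛｝ʳ x y))
    ... | inj₁ e′ with ∈-｛｝⁻ (∈-respʳ e′ (∈-｛｝ʳ x y))
    ...   | inj₁ h = inj₁ h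
    ...   | inj₂ h = inj₁ h

  ⟪⟫-injectiveʳ : ∀ {x x′ y y′} → ⟪ x , y ⟫ ≈ ⟪ x′ , y′ ⟫ → y ≈ y′
  ⟪⟫-injectiveʳ e with second e | second (≈-sym e)
  ... | inj₂ h | _      = h
  ... | inj₁ _ | inj₂ h = ≈-sym h
  -- The degenerate case of pairs that are singletons: all four components coincide.
  ... | inj₁ h | inj₁ k = ≈-trans h (≈-trans (≈-sym (⟪⟫-injectiveˡ e)) (≈-sym k))

module Universe (em : ∀ {a} → ExcludedMiddle a) {ℓ : Level} {U : V ℓ}
  (isU : IsGrothendieckUniverse U) where

  open IsGrothendieckUniverse isU

  ⊆-closed : ∀ {x y} → x ⊆ y → y ∈ U → x ∈ U
  ⊆-closed {x} h y∈U = let (p , p∈U , spec) = powerset y∈U in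
    transitive (from (spec x) h) p∈U

  ∅∈U : ∅ ∈ U
  ∅∈U = transitive (∈-image _ (lift 0)) infinity

  -- The names c i make the index type I small; El J itself may list members repeatedly, so its
  -- size is not bounded by U.
  module SmallIndex {I : Set ℓ} (c : I → V ℓ) {J : V ℓ} (J∈U : J ∈ U) (c∈J : ∀ i → c i ∈ J)
    (c-injective : ∀ {i j} → c i ≈ c j → i ≡ j) (D : I → V ℓ) (D∈U : ∀ i → D i ∈ U) where

    Named : El J → Set ℓ
    Named y = Σ[ i ∈ I ] c i ≈ val y

    -- `unions` takes a family over the set `J`, so `D` is carried along the names; members of `J`
    -- that name nothing contribute the empty set. Injectivity of names makes the family respect
    -- equality of members.
    member : ∀ {y} → Dec (Named y) → V ℓ
    member (yes (i , _)) = D i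
    member (no _)        = ∅

    member-cong : ∀ {y z} → y ∼ z → (p : Dec (Named y)) (q : Dec (Named z)) →
                  member p ≈ member q
    member-cong e (yes (i , p)) (yes (j , q)) =
      ≡⇒≈ (cong D (c-injective (≈-trans p (≈-trans e (≈-sym q)))))
    member-cong e (yes (i , p)) (no ¬q) = contradiction (i , ≈-trans p e) ¬q
    member-cong e (no ¬p) (yes (j , q)) = contradiction (j , ≈-trans q (≈-sym e)) ¬p
    member-cong e (no _) (no _)         = ≈-refl

    member∈U : ∀ {y} (p : Dec (Named y)) → member p ∈ U
    member∈U (yes (i , _)) = D∈U i
    member∈U (no _)        = ∅∈U

    D-member : ∀ {i} (p : Dec (Named (proj₁ (c∈J i)))) → D i ≈ member p
    D-member {i} (yes (j , q)) =
      ≡⇒≈ (cong D (c-injective (≈-trans (proj₂ (c∈J i)) (≈-sym q))))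
    D-member {i} (no ¬p) = contradiction (i , proj₂ (c∈J i)) ¬p

    bound : Σ[ u ∈ V ℓ ] u ∈ U × (∀ i {z} → z ∈ D i → z ∈ u)
    bound =
      let (u , u∈U , spec) = unions J∈U (λ y → member (em {P = Named y}))
                               (λ e → member-cong e em em) (λ y → member∈U em)
      in u , u∈U , λ i {z} z∈ → from (spec z) (proj₁ (c∈J i) , ∈-respʳ (D-member em) z∈)

  open SmallIndex using (bound) public

  -- ∅ and {∅} name the two sets.
  binary-bound : ∀ {a b} → a ∈ U → b ∈ U →
                 Σ[ u ∈ V ℓ ] u ∈ U × (∀ {z} → z ∈ a → z ∈ u) × (∀ {z} → z ∈ b → z ∈ u)
  binary-bound {a} {b} a∈U b∈U =
    let (u , u∈U , h) = bound name infinity (λ i → ∈-image _ (lift (index i))) name-injective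
                              sets sets∈U
    in u , u∈U , h (lift true) , h (lift false)
    where
    index : Lift ℓ Bool → _
    index (lift true)  = 0
    index (lift false) = 1
    name : Lift ℓ Bool → V ℓ
    name i = numeral (index i)
    name-injective : ∀ {i j} → name i ≈ name j → i ≡ j
    name-injective {lift true}  {lift true}  _ = refl
    name-injective {lift false} {lift false} _ = refl
    name-injective {lift true}  {lift false} (_ , h) with h (inj₂ (lift zero))
    ... | lift () , _
    name-injective {lift false} {lift true}  (h , _) with h (inj₂ (lift zero))
    ... | lift () , _
    sets : Lift ℓ Bool → V ℓ
    sets i = if lower i then a else b
    sets∈U : ∀ i → sets i ∈ U
    sets∈U (lift true)  = a∈U
    sets∈U (lift false) = b∈U

  -- A Kuratowski pair of elements of `w` is a set of subsets of `w`, so it lies in the second power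
  -- set.
  pair-bound : ∀ {a b} → a ∈ U → b ∈ U →
               Σ[ u ∈ V ℓ ] u ∈ U × (∀ {x y} → x ∈ a → y ∈ b → ⟪ x , y ⟫ ∈ u)
  pair-bound a∈U b∈U =
    let (w , w∈U , a⊆w , b⊆w) = binary-bound a∈U b∈U
        (p , p∈U , p-spec)    = powerset w∈U
        (q , q∈U , q-spec)    = powerset p∈U
    in q , q∈U , λ x∈a y∈b → from (q-spec _) (｛｝-⊆
         (from (p-spec _) (｛｝-⊆ (a⊆w x∈a) (a⊆w x∈a)))
         (from (p-spec _) (｛｝-⊆ (a⊆w x∈a) (b⊆w y∈b))))

  module _ {I : Set ℓ} (c : I → V ℓ) where

    graph : (D : I → V ℓ) → (∀ i → El (D i)) → V ℓ
    graph D s = sup I λ i → ⟪ c i , val (s i) ⟫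

    graph-injective : (∀ {i j} → c i ≈ c j → i ≡ j) → ∀ D s t →
                      graph D s ≈ graph D t → ∀ i → s i ∼ t i
    graph-injective c-injective D s t (h , _) i =
      let (j , e) = h i in
      ≈-trans (⟪⟫-injectiveʳ e)
              (≡⇒≈ (cong (λ k → val (t k)) (sym (c-injective (⟪⟫-injectiveˡ e)))))

    -- Every graph is a subset of one set of pairs, so a single power set in `U` contains them all,
    -- whatever the sequence.
    graph-bound : ∀ {J} → J ∈ U → (∀ i → c i ∈ J) → (∀ {i j} → c i ≈ c j → i ≡ j) →
                  (D : I → V ℓ) → (∀ i → D i ∈ U) →
                  Σ[ u ∈ V ℓ ] u ∈ U × (∀ s → graph D s ∈ u)
    graph-bound J∈U c∈J c-injective D D∈U =
      let (w , w∈U , D⊆w)    = bound c J∈U c∈J c-injective D D∈U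
          (q , q∈U , pairs)  = pair-bound J∈U w∈U
          (r , r∈U , r-spec) = powerset q∈U
      in r , r∈U , λ s → from (r-spec _) λ { (el i) → pairs (c∈J i) (D⊆w i (val-∈ (s i))) }

-- Ultraproducts of structures

module _ {ℓ : Level} {L : Language ℓ} (M : Structure L) where
  open Structure M

  eval-cong : ∀ {m} {ρ σ : Vector (El D) m} → ρ ≈⃗ σ → ∀ t → eval M ρ t ∼ eval M σ t
  eval-cong e (var i)    = e i
  eval-cong e (app s ts) = fun-cong ≈-refl (λ k → eval-cong e (ts k))

  ∷-cong : ∀ {m a b} {ρ σ : Vector (El D) m} → a ∼ b → ρ ≈⃗ σ → (a ∷ᵛ ρ) ≈⃗ (b ∷ᵛ σ)
  ∷-cong e h zero    = e
  ∷-cong e h (suc k) = h k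

  Sat-cong : ∀ {m} {ρ σ : Vector (El D) m} → ρ ≈⃗ σ → ∀ φ → Sat M ρ φ → Sat M σ φ
  Sat-cong e (t ≐ u)     p = ≈-trans (≈-sym (eval-cong e t)) (≈-trans p (eval-cong e u))
  Sat-cong e (atom s ts) p = rel-cong ≈-refl (λ k → eval-cong e (ts k)) p
  Sat-cong e (neg φ)     p = λ q → p (Sat-cong (λ i → ≈-sym (e i)) φ q)
  Sat-cong e (φ ∧ ψ) (p , q) = Sat-cong e φ p , Sat-cong e ψ q
  Sat-cong e (ex φ) (a , p)  = a , Sat-cong (∷-cong ≈-refl e) φ p

module Ultraproduct (em : ∀ {a} → ExcludedMiddle a) {ℓ : Level} {I : Set ℓ} (𝓕 : Ultrafilter I)
  {L : Language ℓ} (M : I → Structure L) where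

  open Largeness em 𝓕
  open Structure

  Sequence : Set ℓ
  Sequence = ∀ i → El (D (M i))

  -- The quotient by almost-everywhere agreement is formed by set equality: sequences stay as
  -- listed, and their names coincide exactly when they agree almost everywhere. Leaving the names
  -- abstract allows them to carry tags.
  module Naming (name : Sequence → V ℓ)
    (name-cong : ∀ s t → Large (λ i → s i ∼ t i) → name s ≈ name t)
    (name-reflects : ∀ s t → name s ≈ name t → Large (λ i → s i ∼ t i)) where

    terms : El (sup Sequence name) → Sequence
    terms = El.index

    at : ∀ {m} → Vector (El (sup Sequence name)) m → ∀ i → Vector (El (D (M i))) m
    at ρ i k = terms (ρ k) i

    at-cong : ∀ {m} {ρ σ : Vector (El (sup Sequence name)) m} → ρ ≈⃗ σ →
              Large (λ i → at ρ i ≈⃗ at σ i)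
    at-cong {ρ = ρ} {σ} e = large-∀Fin (λ k → name-reflects (terms (ρ k)) (terms (σ k)) (e k))

    ultraproduct : Structure L
    ultraproduct = record
      { D        = sup Sequence name
      ; nonempty = el (λ i → nonempty (M i))
      ; fun      = λ s xs → el (λ i → fun (M i) s (at xs i))
      ; rel      = λ s xs → Large (λ i → rel (M i) s (at xs i))
      ; fun-cong = λ s∼t e → name-cong _ _ (map (λ i → fun-cong (M i) s∼t) (at-cong e))
      ; rel-cong = λ s∼t e → zip (λ i → rel-cong (M i) s∼t) (at-cong e)
      }

    eval-at : ∀ {m} (ρ : Vector (El (D ultraproduct)) m) t i →
              terms (eval ultraproduct ρ t) i ∼ eval (M i) (at ρ i) t
    eval-at ρ (var k)    i = ≈-refl
    eval-at ρ (app s ts) i = fun-cong (M i) ≈-refl (λ k → eval-at ρ (ts k) i)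

    choose : ∀ {i p} {P : El (D (M i)) → Set p} → Dec (Σ _ P) → El (D (M i))
    choose     (yes (a , _)) = a
    choose {i} (no _)        = nonempty (M i)

    choose-spec : ∀ {i p} {P : El (D (M i)) → Set p} (d : Dec (Σ _ P)) → Σ _ P → P (choose d)
    choose-spec (yes (_ , p)) _ = p
    choose-spec (no ¬p)       p = contradiction p ¬p

    Łoś : ∀ {m} (φ : Formula L m) (ρ : Vector (El (D ultraproduct)) m) →
          Sat ultraproduct ρ φ ⇔ Large (λ i → Sat (M i) (at ρ i) φ)
    Łoś (t ≐ u) ρ = mk⇔
      (λ e → map (λ i h → ≈-trans (≈-sym (eval-at ρ t i)) (≈-trans h (eval-at ρ u i)))
                 (name-reflects (terms (eval ultraproduct ρ t)) (terms (eval ultraproduct ρ u)) e))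
      (λ l → name-cong _ _ (map (λ i h → ≈-trans (eval-at ρ t i) (≈-trans h (≈-sym (eval-at ρ u i)))) l))
    Łoś (atom s ts) ρ = mk⇔
      (map (λ i → rel-cong (M i) ≈-refl (λ k → eval-at ρ (ts k) i)))
      (map (λ i → rel-cong (M i) ≈-refl (λ k → ≈-sym (eval-at ρ (ts k) i))))
    Łoś (neg φ) ρ = mk⇔
      (λ ¬p → large-¬ (λ l → ¬p (from (Łoś φ ρ) l)))
      (λ l p → let (_ , q , ¬q) = witness (zip (λ i → _,_) (to (Łoś φ ρ) p) l) in ¬q q)
    Łoś (φ ∧ ψ) ρ = mk⇔
      (λ (p , q) → zip (λ i → _,_) (to (Łoś φ ρ) p) (to (Łoś ψ ρ) q))
      (λ l → from (Łoś φ ρ) (map (λ i → proj₁) l) , from (Łoś ψ ρ) (map (λ i → proj₂) l))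
    Łoś (ex φ) ρ = mk⇔
      (λ (a , p) → map (λ i q → terms a i , Sat-cong (M i) (at-∷ a i) φ q) (to (Łoś φ (a ∷ᵛ ρ)) p))
      -- Indices without a witness get the default element from `nonempty`; almost every index has
      -- one.
      (λ l → let s = λ i → choose (em {P = Σ _ (λ a → Sat (M i) (a ∷ᵛ at ρ i) φ)}) in
        el s , from (Łoś φ (el s ∷ᵛ ρ))
          (map (λ i q → Sat-cong (M i) (λ k → ≈-sym (at-∷ (el s) i k)) φ (choose-spec em q)) l))
      where
      at-∷ : ∀ a i → at (a ∷ᵛ ρ) i ≈⃗ (terms a i ∷ᵛ at ρ i)
      at-∷ a i zero    = ≈-refl
      at-∷ a i (suc k) = ≈-refl

    ultraproduct-⊨ : ∀ {T} → (∀ i → M i ⊨ T) → ultraproduct ⊨ T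
    ultraproduct-⊨ h φ φ∈T = from (Łoś φ []ᵛ) (always (λ i → Sat-cong (M i) (λ ()) φ (h i φ φ∈T)))

-- Realising finite diagrams

-- Objects are represented by their identities, so only relations among morphisms are recorded.
-- Every shape is given three variables, some ignored, to allow uniform treatment.
data Shape : Set where
  equal identity composite : Shape

formula : ∀ {n} → Shape → (x y z : Fin n) → CatFormula 0 n
formula equal     x y z = var x ≐ᵐ var y
formula identity  x y z = var x ≐ᵐ Id (dom (var x))
formula composite x y z = comp (var x) (var y) (var z)

-- The empty conjunction has to be expressed without free variables, and this sentence holds even in
-- a category with no objects.
verum : ∀ {m n} → CatFormula m n
verum = neg (exᵒ (neg (var zero ≐ᵒ var zero)))

⋀ : ∀ {m n} k → (Fin k → CatFormula m n) → CatFormula m n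
⋀ ℕ.zero    φ = verum
⋀ (ℕ.suc k) φ = φ zero ∧ ⋀ k (λ i → φ (suc i))

closure : ∀ n → CatFormula 0 n → CatFormula 0 0
closure ℕ.zero    φ = φ
closure (ℕ.suc n) φ = closure n (exᵐ φ)

signed : ∀ {p m n} {P : Set p} → Dec P → CatFormula m n → CatFormula m n
signed (yes _) φ = φ
signed (no _)  φ = neg φ

entries : ∀ {a} {A : Set a} (l : List A) → Vector A (length l)
entries []      = []ᵛ
entries (x ∷ l) = x ∷ᵛ entries l

entries-all : ∀ {a p} {A : Set a} {P : A → Set p} (l : List A) → (∀ k → P (entries l k)) → All P l
entries-all []      h = []
entries-all (x ∷ l) h = h zero ∷ entries-all l (λ k → h (suc k))

module _ {o e m e′ : Level} {Ob : Setoid o e} {Mor : Setoid m e′} (C : Category Ob Mor) where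
  private
    module O = Setoid Ob
    module M = Setoid Mor
    module C = Category C

  Holds : Shape → (f g h : M.Carrier) → Set (e ⊔ e′)
  Holds equal     f g h = Lift e (f M.≈ g)
  Holds identity  f g h = Lift e (f M.≈ (C.Id ⟨$⟩ (C.dom ⟨$⟩ f)))
  Holds composite f g h = C.Comp f g h

  Holds-cong : ∀ s {f f′ g g′ h h′} → f M.≈ f′ → g M.≈ g′ → h M.≈ h′ →
               Holds s f g h → Holds s f′ g′ h′
  Holds-cong equal     p q r (lift e) = lift (M.trans (M.sym p) (M.trans e q))
  Holds-cong identity  p q r (lift e) =
    lift (M.trans (M.sym p) (M.trans e (Func.cong C.Id (Func.cong C.dom p))))
  Holds-cong composite p q r (c , e) =
    c′ , M.trans (C.comp-cong c′ c (M.sym p) (M.sym q)) (M.trans e r)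
    where c′ = O.trans (Func.cong C.dom (M.sym p)) (O.trans c (Func.cong C.rng q))

  formula-sat : ∀ {n} (ρ : Vector O.Carrier 0) (σ : Vector M.Carrier n) s x y z →
                CatSat C ρ σ (formula {n} s x y z) ⇔ Holds s (σ x) (σ y) (σ z)
  formula-sat ρ σ equal     x y z = mk⇔ (λ p → lift (lower p)) (λ p → lift (lower p))
  formula-sat ρ σ identity  x y z = mk⇔ (λ p → lift (lower p)) (λ p → lift (lower p))
  formula-sat ρ σ composite x y z = mk⇔ lower lift

  module _ {k n} {ρ : Vector O.Carrier k} {σ : Vector M.Carrier n} where

    ⋀-sat : ∀ j {φ} → CatSat C ρ σ (⋀ j φ) ⇔ (∀ i → CatSat C ρ σ (φ i))
    ⋀-sat ℕ.zero    = mk⇔ (λ _ ()) (λ _ (_ , ¬refl) → ¬refl (lift O.refl))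
    ⋀-sat (ℕ.suc j) = mk⇔
      (λ { (p , q) zero → p ; (p , q) (suc i) → to (⋀-sat j) q i })
      (λ h → h zero , from (⋀-sat j) (λ i → h (suc i)))

  closure⁺ : ∀ l {φ} → CatSat C []ᵛ (entries l) φ → CatSat C []ᵛ []ᵛ (closure (length l) φ)
  closure⁺ []      p = p
  closure⁺ (f ∷ l) p = closure⁺ l (f , p)

  closure⁻ : ∀ n {φ} → CatSat C []ᵛ []ᵛ (closure n φ) → Σ[ σ ∈ Vector M.Carrier n ] CatSat C []ᵛ σ φ
  closure⁻ ℕ.zero    p = []ᵛ , p
  closure⁻ (ℕ.suc n) p = let (σ , f , q) = closure⁻ n p in f ∷ᵛ σ , q

-- Approximating the small category along finite sets of its morphisms

module Compactness (em : ∀ {a} → ExcludedMiddle a) (ac : ∀ {a b} → AxiomOfChoice a b)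
  {ℓ : Level} {U : V ℓ} (isU : IsGrothendieckUniverse U) (𝒞 : SmallCategory U)
  {o e m e′ : Level} {Ob : Setoid o e} {Mor : Setoid m e′} (E : Category Ob Mor)
  (equivalent : ElementarilyEquivalent (SmallCategory.category 𝒞) E) where

  open Classical em
  open SmallCategory 𝒞 renaming (category to C)
  open IsGrothendieckUniverse isU
  private module M = Setoid Mor

  literal : (l : List (El mors)) → Shape → (x y z : Fin (length l)) → CatFormula 0 (length l)
  literal l s x y z =
    signed (em {P = Holds C s (entries l x) (entries l y) (entries l z)}) (formula s x y z)

  -- The negative literals are what later separates distinct morphisms.
  diagram : (l : List (El mors)) → CatFormula 0 (length l)
  diagram l = ⋀ n λ x → ⋀ n λ y → ⋀ n λ z →
    literal l equal x y z ∧ (literal l identity x y z ∧ literal l composite x y z)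
    where n = length l

  literal-true : ∀ l s x y z → CatSat C []ᵛ (entries l) (literal l s x y z)
  literal-true l s x y z with em {P = Holds C s (entries l x) (entries l y) (entries l z)}
  ... | yes p = from (formula-sat C []ᵛ (entries l) s x y z) p
  ... | no ¬p = λ q → ¬p (to (formula-sat C []ᵛ (entries l) s x y z) q)

  diagram-true : ∀ l → CatSat C []ᵛ (entries l) (diagram l)
  diagram-true l = from (⋀-sat C n) λ x → from (⋀-sat C n) λ y → from (⋀-sat C n) λ z →
    literal-true l equal x y z , literal-true l identity x y z , literal-true l composite x y z
    where n = length l

  SameType : ∀ l → Vector M.Carrier (length l) → Set _
  SameType l τ = ∀ s x y z →
    Holds C s (entries l x) (entries l y) (entries l z) ⇔ Holds E s (τ x) (τ y) (τ z)

  literal⇒ : ∀ l (τ : Vector M.Carrier (length l)) s x y z → CatSat E []ᵛ τ (literal l s x y z) →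
             Holds C s (entries l x) (entries l y) (entries l z) ⇔ Holds E s (τ x) (τ y) (τ z)
  literal⇒ l τ s x y z h with em {P = Holds C s (entries l x) (entries l y) (entries l z)}
  ... | yes p = mk⇔ (λ _ → to (formula-sat E []ᵛ τ s x y z) h) (λ _ → p)
  ... | no ¬p = mk⇔ (λ p → contradiction p ¬p)
                    (λ q → contradiction (from (formula-sat E []ᵛ τ s x y z) q) h)

  -- The existential closure of the diagram is a sentence true in `C`, hence in `E`, and its
  -- witnesses there stand in the same relations.
  realise : ∀ l → Σ (Vector M.Carrier (length l)) (SameType l)
  realise l = τ , λ where
      equal     x y z → literal⇒ l τ equal x y z (proj₁ (literals x y z))
      identity  x y z → literal⇒ l τ identity x y z (proj₁ (proj₂ (literals x y z)))
      composite x y z → literal⇒ l τ composite x y z (proj₂ (proj₂ (literals x y z)))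
    where
    n = length l
    realisation = closure⁻ E n (to (equivalent (closure n (diagram l)))
                                   (closure⁺ C l (diagram-true l)))
    τ = proj₁ realisation
    literals : ∀ x y z → CatSat E []ᵛ τ
      (literal l equal x y z ∧ (literal l identity x y z ∧ literal l composite x y z))
    literals x y z = to (⋀-sat E n) (to (⋀-sat E n) (to (⋀-sat E n) (proj₂ realisation) x) y) z

  members : List (El mors) → V ℓ
  members l = sup (Lift ℓ (Fin (length l))) λ k → val (entries l (lower k))

  Lists : Setoid ℓ ℓ
  Lists = record
    { Carrier = List (El mors)
    ; _≈_ = λ k l → members k ≈ members l
    ; isEquivalence = record { refl = ≈-refl ; sym = ≈-sym ; trans = ≈-trans } }

  canonical : List (El mors) → List (El mors)
  canonical = proj₁ (ac Lists)

  canonical-≈ : ∀ l → members (canonical l) ≈ members l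
  canonical-≈ = proj₁ (proj₂ (ac Lists))

  canonical-cong : ∀ {k l} → members k ≈ members l → canonical k ≡ canonical l
  canonical-cong = proj₂ (proj₂ (ac Lists))

  -- The finite subsets of mors, each enumerated by one list, so that distinct indices
  -- have distinct names in the power set of mors.
  I : Set ℓ
  I = Σ[ l ∈ List (El mors) ] canonical l ≡ l

  name : I → V ℓ
  name (l , _) = members l

  name-injective : ∀ {i j} → name i ≈ name j → i ≡ j
  name-injective {k , p} {l , q} e = go (trans (sym p) (trans (canonical-cong e) q)) p q
    where
    go : ∀ {k l} → k ≡ l → (p : canonical k ≡ k) (q : canonical l ≡ l) →
         _≡_ {A = I} (k , p) (l , q)
    go refl p q = cong (_ ,_) (uip p q)
      where
      uip : ∀ {a} {A : Set a} {x y : A} (p q : x ≡ y) → p ≡ q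
      uip refl refl = refl

  names : V ℓ
  names = proj₁ (powerset mors∈U)

  names∈U : names ∈ U
  names∈U = proj₁ (proj₂ (powerset mors∈U))

  name∈names : ∀ i → name i ∈ names
  name∈names (l , _) =
    from (proj₂ (proj₂ (powerset mors∈U)) _) λ { (el k) → val-∈ (entries l (lower k)) }

  Occurs : El mors → I → Set ℓ
  Occurs f (l , _) = Σ[ k ∈ Fin (length l) ] entries l k ∼ f

  directed : (l : List (El mors)) → Σ[ i ∈ I ] All (λ f → Occurs f i) l
  directed l = (canonical l , canonical-cong (canonical-≈ l)) , entries-all l λ k →
    let (k′ , e) = proj₂ (canonical-≈ l) (lift k) in lower k′ , e

  open ConeUltrafilter em ac Occurs directed using (ultrafilter; cone) public
  open Largeness em ultrafilter

  pick : ∀ f (i : I) → Dec (Occurs f i) → M.Carrier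
  pick f (l , _) (yes (k , _)) = proj₁ (realise l) k
  -- A default morphism of `E`, which realising the one-element list of `f` always supplies.
  pick f _       (no _)        = proj₁ (realise (f ∷ [])) zero

  mor : El mors → I → M.Carrier
  mor f i = pick f i em

  pick-spec : ∀ s {f g h} (i : I) → Occurs f i → Occurs g i → Occurs h i →
    (p : Dec (Occurs f i)) (q : Dec (Occurs g i)) (r : Dec (Occurs h i)) →
    Holds C s f g h ⇔ Holds E s (pick f i p) (pick g i q) (pick h i r)
  pick-spec s (l , _) a b c (yes (x , p)) (yes (y , q)) (yes (z , r)) =
    let same = proj₂ (realise l) s x y z in mk⇔
      (λ u → to same (Holds-cong C s (≈-sym p) (≈-sym q) (≈-sym r) u))
      (λ v → Holds-cong C s p q r (from same v))
  pick-spec s i a b c (no ¬a) _ _ = contradiction a ¬a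
  pick-spec s i a b c _ (no ¬b) _ = contradiction b ¬b
  pick-spec s i a b c _ _ (no ¬c) = contradiction c ¬c

  -- On the intersection of the three cones all of `f`, `g`, `h` occur in the list, and one
  -- realisation handles them together. The positions found are arbitrary, since the relations
  -- respect equality of morphisms.
  mor-spec : ∀ s f g h →
    Large (λ i → Holds C s f g h ⇔ Holds E s (mor f i) (mor g i) (mor h i))
  mor-spec s f g h = zip (λ i (a , b) c → pick-spec s i a b c em em em)
    (zip (λ i → _,_) (large (cone f)) (large (cone g))) (large (cone h))

-- The ultraproduct functor

module ModelEmbedding (em : ∀ {a} → ExcludedMiddle a) (ac : ∀ {a b} → AxiomOfChoice a b)
  {ℓ : Level} {U : V ℓ} (isU : IsGrothendieckUniverse U) {L : Language ℓ} (T : Theory L)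
  (𝒞 : SmallCategory U) {I : Set ℓ} (𝓕 : Ultrafilter I)
  (name : I → V ℓ) {J : V ℓ} (J∈U : J ∈ U) (name∈J : ∀ i → name i ∈ J)
  (name-injective : ∀ {i j} → name i ≈ name j → i ≡ j)
  (mor : El (SmallCategory.mors 𝒞) → I → ModelMorphism U T)
  (mor-spec : ∀ s f g h → Largeness.Large em 𝓕 (λ i →
    Holds (SmallCategory.category 𝒞) s f g h ⇔ Holds (Mod U T) s (mor f i) (mor g i) (mor h i)))
  where

  open Classical em
  open Largeness em 𝓕
  open Universe em isU
  open SmallCategory 𝒞 renaming (category to C)
  open Structure
  open SmallModel
  open ModelMorphism
  open Hom renaming (map to ⟦_⟧)
  open _≋_
  open _≈ᵐ_
  private
    module C = Category C
    module Mod = Category (Mod U T)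
    module Mors = Setoid (ModelMorphisms U T)

  mor-holds : ∀ s {f g h} → Holds C s f g h →
              Large (λ i → Holds (Mod U T) s (mor f i) (mor g i) (mor h i))
  mor-holds s p = map (λ i q → to q p) (mor-spec s _ _ _)

  -- Only morphisms were realised; an object is read off from its identity.
  model : El obs → I → SmallModel U T
  model a i = source (mor (C.Id ⟨$⟩ a) i)

  M : El obs → I → Structure L
  M a i = structure (model a i)

  Sequences : El obs → Setoid ℓ ℓ
  Sequences a = record
    { Carrier = ∀ i → El (D (M a i))
    ; _≈_ = λ s t → Large (λ i → s i ∼ t i)
    ; isEquivalence = record
      { refl  = always (λ i → ≈-refl)
      ; sym   = map (λ i → ≈-sym)
      ; trans = zip (λ i → ≈-trans) } }

  Sequence : El obs → Set ℓ
  Sequence a = Setoid.Carrier (Sequences a)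

  opaque
    -- Stands for the class of `s` modulo almost-everywhere agreement: the graph of its chosen
    -- representative, instead of the class itself.
    code : ∀ a → Sequence a → V ℓ
    code a s = graph name (λ i → D (M a i)) (proj₁ (ac (Sequences a)) s)

    codes-bound : ∀ a → Σ[ u ∈ V ℓ ] u ∈ U × (∀ s → code a s ∈ u)
    codes-bound a =
      let (u , u∈U , h) = graph-bound name J∈U name∈J name-injective (λ i → D (M a i))
                            (λ i → small (model a i))
      in u , u∈U , λ s → h (proj₁ (ac (Sequences a)) s)

    -- The component val a keeps the ultraproducts of distinct objects distinct.
    label : ∀ a → Sequence a → V ℓ
    label a s = ⟪ val a , code a s ⟫

    label-cong : ∀ a s t → Large (λ i → s i ∼ t i) → label a s ≈ label a t
    label-cong a s t e = ≡⇒≈ (cong (λ u → ⟪ val a , graph name _ u ⟫)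
                                  (proj₂ (proj₂ (ac (Sequences a))) e))

    label-reflects : ∀ a s t → label a s ≈ label a t → Large (λ i → s i ∼ t i)
    label-reflects a s t e = S.trans (S.sym (canonical-≈ s)) (S.trans
      (always (graph-injective name name-injective (λ i → D (M a i)) _ _ (⟪⟫-injectiveʳ e)))
      (canonical-≈ t))
      where
      module S = Setoid (Sequences a)
      canonical-≈ : ∀ s → proj₁ (ac (Sequences a)) s S.≈ s
      canonical-≈ = proj₁ (proj₂ (ac (Sequences a)))

    label-object : ∀ {a b} s t → label a s ≈ label b t → a ∼ b
    label-object s t = ⟪⟫-injectiveˡ

    -- The type `Sequence a` carries no size bound from `U`; what counts is that all labels are
    -- members of one set in `U`.
    labels-small : ∀ a → sup (Sequence a) (label a) ∈ U
    labels-small a =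
      let (u , u∈U , code∈u)  = codes-bound a
          (p , p∈U , pair∈p) = pair-bound obs∈U u∈U
      in ⊆-closed (λ { (el s) → pair∈p (val-∈ a) (code∈u s) }) p∈U

  module UP (a : El obs) = Ultraproduct.Naming em 𝓕 (M a) (label a) (label-cong a) (label-reflects a)

  ultraproduct : El obs → Structure L
  ultraproduct = UP.ultraproduct

  object : El obs → SmallModel U T
  object a = record
    { structure = ultraproduct a
    ; small     = labels-small a
    ; models    = UP.ultraproduct-⊨ a (λ i → models (model a i))
    }

  label⁺ : ∀ {a b} → a ≡ b → (s : El (D (ultraproduct a))) (t : El (D (ultraproduct b))) →
           Large (λ i → UP.terms a s i ∼ UP.terms b t i) → s ∼ t
  label⁺ refl s t = label-cong _ _ _

  label⁻ : ∀ {a b} → a ≡ b → (s : El (D (ultraproduct a))) (t : El (D (ultraproduct b))) →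
           s ∼ t → Large (λ i → UP.terms a s i ∼ UP.terms b t i)
  label⁻ refl s t = label-reflects _ _ _

  -- Two listings of the same object may have different models at some indices, hence different
  -- ultraproducts. One chosen listing per object turns equality of objects into `≡`.
  ⌈_⌉ : El obs → El obs
  ⌈_⌉ = proj₁ (ac (ElSetoid obs))

  ⌈⌉-∼ : ∀ a → ⌈ a ⌉ ∼ a
  ⌈⌉-∼ = proj₁ (proj₂ (ac (ElSetoid obs)))

  ⌈⌉-cong : ∀ {a b} → a ∼ b → ⌈ a ⌉ ≡ ⌈ b ⌉
  ⌈⌉-cong = proj₂ (proj₂ (ac (ElSetoid obs)))

  ⌈⌉-injective : ∀ {a b} → ⌈ a ⌉ ∼ ⌈ b ⌉ → a ∼ b
  ⌈⌉-injective {a} {b} e = ≈-trans (≈-sym (⌈⌉-∼ a)) (≈-trans e (⌈⌉-∼ b))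

  ultraproduct-cong : ∀ {a b} → a ≡ b → ultraproduct a ≋ ultraproduct b
  ultraproduct-cong refl = ≋-refl

  ultraproduct-injective : ∀ {a b} → ultraproduct a ≋ ultraproduct b → a ∼ b
  ultraproduct-injective {a} {b} e =
    -- Nonemptiness provides an element whose tag can be compared.
    let (t , h) = proj₁ (D-eq e) (λ i → nonempty (M a i)) in label-object _ t h

  -- Homomorphisms between the ultraproducts

  arrow : ∀ {a b i} → Hom (M a i) (M b i) → ModelMorphism U T
  arrow {a} {b} {i} h = record { source = model a i ; target = model b i ; hom = h }

  -- At exceptional indices there may be no homomorphism between the two models at all. So `φ` is a
  -- bare map, and this record says when it is `mor f i` up to equality of the endpoints.
  record Represents (f : El mors) (i : I)
    (φ : El (D (M ⌈ C.dom ⟨$⟩ f ⌉ i)) → El (D (M ⌈ C.rng ⟨$⟩ f ⌉ i))) : Set ℓ where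
    field
      represented : Hom (M ⌈ C.dom ⟨$⟩ f ⌉ i) (M ⌈ C.rng ⟨$⟩ f ⌉ i)
      agrees      : ∀ x → φ x ∼ ⟦ represented ⟧ x
      equals      : arrow {⌈ C.dom ⟨$⟩ f ⌉} {⌈ C.rng ⟨$⟩ f ⌉} {i} represented Mors.≈ mor f i
      strong      : IsStrong (hom (mor f i)) → IsStrong represented

  open Represents

  -- Composability carries the information about endpoints: `f` composes with the identity of its
  -- domain, so at almost every index the source of `mor f i` is the target of that realised
  -- identity, which equals its source.
  dom-model : ∀ f → Large (λ i → M ⌈ C.dom ⟨$⟩ f ⌉ i ≋ structure (source (mor f i)))
  dom-model f = zip
    (λ i (lift id≈) (f∘id , _) → ≋-sym (≋-trans f∘id (target-eq id≈)))
    (mor-holds identity {g = f} {h = f} (lift (Func.cong C.Id (≈-sym (C.dom-Id a)))))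
    (mor-holds composite (e , ≈-refl))
    where
    a = ⌈ C.dom ⟨$⟩ f ⌉
    e : C.dom ⟨$⟩ f ∼ C.rng ⟨$⟩ (C.Id ⟨$⟩ a)
    e = ≈-sym (≈-trans (C.rng-Id a) (⌈⌉-∼ _))

  rng-model : ∀ f → Large (λ i → M ⌈ C.rng ⟨$⟩ f ⌉ i ≋ structure (target (mor f i)))
  rng-model f = map (λ i → proj₁) (mor-holds composite (e , ≈-refl))
    where
    a = ⌈ C.rng ⟨$⟩ f ⌉
    e : C.dom ⟨$⟩ (C.Id ⟨$⟩ a) ∼ C.rng ⟨$⟩ f
    e = ≈-trans (C.dom-Id a) (⌈⌉-∼ _)

  Representable : El mors → I → Set ℓ
  Representable f i = Σ _ (Represents f i)

  representable : ∀ f → Large (Representable f)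
  representable f = zip (λ i p q → _ , record
    { represented = ≋⇒Hom (≋-sym q) ∘ʰ hom (mor f i) ∘ʰ ≋⇒Hom p
    ; agrees      = λ x → ≈-refl
    ; equals      = record
      { source-eq = p
      ; target-eq = q
      ; map-eq    = λ x y e → ≈-trans (cast-∼ (D-eq (≋-sym q)) _)
          (map-cong (hom (mor f i)) (≈-trans (cast-∼ (D-eq p) x) e)) }
    ; strong      = λ s → ∘ʰ-strong (≋⇒Hom (≋-sym q)) (hom (mor f i) ∘ʰ ≋⇒Hom p)
        (≋⇒Hom-strong (≋-sym q)) (∘ʰ-strong (hom (mor f i)) (≋⇒Hom p) s (≋⇒Hom-strong p))
    }) (dom-model f) (rng-model f)

  apply : ∀ {f i} → Dec (Representable f i) →
          El (D (M ⌈ C.dom ⟨$⟩ f ⌉ i)) → El (D (M ⌈ C.rng ⟨$⟩ f ⌉ i))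
  apply         (yes (φ , _)) = φ
  apply {f} {i} (no _)        = λ _ → nonempty (M ⌈ C.rng ⟨$⟩ f ⌉ i)

  act : ∀ f i → El (D (M ⌈ C.dom ⟨$⟩ f ⌉ i)) → El (D (M ⌈ C.rng ⟨$⟩ f ⌉ i))
  act f i = apply em

  act-represents : ∀ f → Large (λ i → Represents f i (act f i))
  act-represents f = map (λ i → go i em) (representable f)
    where
    go : ∀ i (d : Dec (Representable f i)) → Representable f i → Represents f i (apply d)
    go i (yes (_ , r)) _ = r
    go i (no ¬r)       r = contradiction r ¬r

  opaque
    arrowHom : ∀ f → Hom (ultraproduct ⌈ C.dom ⟨$⟩ f ⌉) (ultraproduct ⌈ C.rng ⟨$⟩ f ⌉)
    arrowHom f = record
      { map      = λ x → el (λ i → act f i (UP.terms a x i))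
      ; map-cong = λ {x} {y} e → label-cong b _ _ (zip
          (λ i r e → ≈-trans (agrees r _) (≈-trans (map-cong (represented r) e) (≈-sym (agrees r _))))
          (act-represents f) (label⁻ refl x y e))
      ; map-fun  = λ s xs → label-cong b _ _ (map
          (λ i r → ≈-trans (agrees r _) (≈-trans (map-fun (represented r) s (UP.at a xs i))
            (fun-cong (M b i) ≈-refl (λ k → ≈-sym (agrees r _)))))
          (act-represents f))
      ; map-rel  = λ s xs → zip
          (λ i r p → rel-cong (M b i) ≈-refl (λ k → ≈-sym (agrees r _))
                       (map-rel (represented r) s (UP.at a xs i) p))
          (act-represents f)
      }
      where
      a b : El obs
      a = ⌈ C.dom ⟨$⟩ f ⌉
      b = ⌈ C.rng ⟨$⟩ f ⌉

    arrowHom-strong : ∀ f → (∀ i → IsStrong (hom (mor f i))) → IsStrong (arrowHom f)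
    arrowHom-strong f h s xs = mk⇔ (map-rel (arrowHom f) s xs) (zip
      (λ i r p → from (strong r (h i) s (UP.at ⌈ C.dom ⟨$⟩ f ⌉ xs i))
                   (rel-cong (M ⌈ C.rng ⟨$⟩ f ⌉ i) ≈-refl (λ k → agrees r _) p))
      (act-represents f))

  F₁ : El mors → ModelMorphism U T
  F₁ f = record
    { source = object ⌈ C.dom ⟨$⟩ f ⌉ ; target = object ⌈ C.rng ⟨$⟩ f ⌉ ; hom = arrowHom f }

  opaque
    unfolding arrowHom

    F₁-cong : ∀ {f g} → f ∼ g → F₁ f Mors.≈ F₁ g
    F₁-cong {f} {g} f∼g = record
      { source-eq = ultraproduct-cong dom-eq
      ; target-eq = ultraproduct-cong rng-eq
      ; map-eq    = λ x y e → label⁺ rng-eq _ _ (zip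
          (λ i ((r , r′) , lift f≈g) e → ≈-trans (agrees r _) (≈-trans
             (map-eq (Mors.trans (equals r) (Mors.trans f≈g (Mors.sym (equals r′)))) _ _ e)
             (≈-sym (agrees r′ _))))
          (zip (λ i → _,_) (zip (λ i → _,_) (act-represents f) (act-represents g))
                           (mor-holds equal {f} {g} {f} (lift f∼g)))
          (label⁻ dom-eq x y e))
      }
      where
      dom-eq : ⌈ C.dom ⟨$⟩ f ⌉ ≡ ⌈ C.dom ⟨$⟩ g ⌉
      dom-eq = ⌈⌉-cong (Func.cong C.dom {f} {g} f∼g)
      rng-eq : ⌈ C.rng ⟨$⟩ f ⌉ ≡ ⌈ C.rng ⟨$⟩ g ⌉
      rng-eq = ⌈⌉-cong (Func.cong C.rng {f} {g} f∼g)

    F₁-Id : ∀ a → F₁ (C.Id ⟨$⟩ a) Mors.≈ (Mod.Id ⟨$⟩ object ⌈ a ⌉)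
    F₁-Id a = record
      { source-eq = ultraproduct-cong dom-eq
      ; target-eq = ultraproduct-cong rng-eq
      ; map-eq    = λ x y e → label⁺ rng-eq _ y (zip
          (λ i (r , lift id≈) e → ≈-trans (agrees r _) (≈-trans (acts-trivially
             (Mors.trans (equals r) id≈) _) e))
          (zip (λ i → _,_) (act-represents (C.Id ⟨$⟩ a))
             (mor-holds identity {g = C.Id ⟨$⟩ a} {h = C.Id ⟨$⟩ a}
                (lift (Func.cong C.Id (≈-sym (C.dom-Id a))))))
          (label⁻ dom-eq x y e))
      }
      where
      dom-eq : ⌈ C.dom ⟨$⟩ (C.Id ⟨$⟩ a) ⌉ ≡ ⌈ a ⌉
      dom-eq = ⌈⌉-cong (C.dom-Id a)
      rng-eq : ⌈ C.rng ⟨$⟩ (C.Id ⟨$⟩ a) ⌉ ≡ ⌈ a ⌉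
      rng-eq = ⌈⌉-cong (C.rng-Id a)
      acts-trivially : ∀ {f N} (e : f Mors.≈ (Mod.Id ⟨$⟩ N)) x → ⟦ hom f ⟧ x ∼ x
      acts-trivially e x =
        let d = D-eq (source-eq e) in
        ≈-trans (map-eq e x (cast d x) (≈-sym (cast-∼ d x))) (cast-∼ d x)

    F₁-comp : ∀ g f p q → F₁ (C.comp g f p) Mors.≈ Mod.comp (F₁ g) (F₁ f) q
    F₁-comp g f p q = record
      { source-eq = ultraproduct-cong dom-eq
      ; target-eq = ultraproduct-cong rng-eq
      ; map-eq    = λ x y e →
          -- `Mod.comp` joins its factors by a cast along `q`; `w` is the image of `y` after that
          -- cast.
          let w = cast (D-eq (≋-sym q)) (⟦ arrowHom f ⟧ y) in
          label⁺ rng-eq (⟦ arrowHom (C.comp g f p) ⟧ x) (⟦ arrowHom g ⟧ w) (zip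
            (λ i ((r , s) , (t , g∘f)) (e , e′) → pointwise i r s t g∘f e e′)
            (zip (λ i → _,_)
               (zip (λ i → _,_) (act-represents f) (act-represents g))
               (zip (λ i → _,_) (act-represents (C.comp g f p))
                    (mor-holds composite (p , ≈-refl))))
            (zip (λ i → _,_) (label⁻ dom-eq x y e)
                 (label⁻ (⌈⌉-cong p) w _ (cast-∼ (D-eq (≋-sym q)) _))))
      }
      where
      dom-eq : ⌈ C.dom ⟨$⟩ C.comp g f p ⌉ ≡ ⌈ C.dom ⟨$⟩ f ⌉
      dom-eq = ⌈⌉-cong (C.dom-comp g f p)
      rng-eq : ⌈ C.rng ⟨$⟩ C.comp g f p ⌉ ≡ ⌈ C.rng ⟨$⟩ g ⌉
      rng-eq = ⌈⌉-cong (C.rng-comp g f p)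
      pointwise : ∀ i → Represents f i (act f i) → Represents g i (act g i) →
        Represents (C.comp g f p) i (act (C.comp g f p) i) →
        Mod.Comp (mor g i) (mor f i) (mor (C.comp g f p) i) →
        ∀ {x y w} → x ∼ y → w ∼ act f i y → act (C.comp g f p) i x ∼ act g i w
      pointwise i r s t (c , g∘f) {x} {y} {w} x∼y w∼fy =
        let d  = D-eq (source-eq (equals r))
            z  = cast d y
            z∼ = cast-∼ d y
            u∼ = cast-∼ (D-eq (≋-sym c)) (⟦ hom (mor f i) ⟧ z)
        in ≈-trans (agrees t x)
          (≈-trans (map-eq (Mors.trans (equals t) (Mors.sym g∘f)) x z (≈-trans x∼y (≈-sym z∼)))
          (≈-trans (≈-sym (map-eq (equals s) w _ (≈-trans w∼fy (≈-trans (agrees r y)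
                     (≈-trans (map-eq (equals r) y z (≈-sym z∼)) (≈-sym u∼))))))
                   (≈-sym (agrees s w))))

    -- If `f` and `g` differ, so do their realisations at almost every index. Injectivity on objects
    -- identifies the endpoints, so the maps themselves differ somewhere; such points form a
    -- sequence on which the two images disagree.
    F₁-injective : ∀ {f g} → F₁ f Mors.≈ F₁ g → f ∼ g
    F₁-injective {f} {g} F≈ = by-contradiction λ f≁g →
      let differ   = zip (λ i → separated i) (zip (λ i → _,_) (act-represents f) (act-represents g))
                       (map (λ i q e → f≁g (lower (from q (lift e)))) (mor-spec equal f g f))
          s        = el (λ i → proj₁ (choice i em))
          t        = el (λ i → proj₂ (choice i em))
          s∼t      = label⁺ dom-eq s t (map (λ i b → proj₁ (choice-spec i em b)) differ)
          equal    = label⁻ rng-eq (⟦ arrowHom f ⟧ s) (⟦ arrowHom g ⟧ t) (map-eq F≈ s t s∼t)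
          distinct = map (λ i b → proj₂ (choice-spec i em b)) differ
          (_ , e , ¬e) = witness (zip (λ i → _,_) equal distinct)
      in ¬e e
      where
      dom-eq : ⌈ C.dom ⟨$⟩ f ⌉ ≡ ⌈ C.dom ⟨$⟩ g ⌉
      dom-eq = ⌈⌉-cong (⌈⌉-injective (ultraproduct-injective (source-eq F≈)))
      rng-eq : ⌈ C.rng ⟨$⟩ f ⌉ ≡ ⌈ C.rng ⟨$⟩ g ⌉
      rng-eq = ⌈⌉-cong (⌈⌉-injective (ultraproduct-injective (target-eq F≈)))

      A B : I → Set ℓ
      A i = El (D (M ⌈ C.dom ⟨$⟩ f ⌉ i))
      B i = El (D (M ⌈ C.dom ⟨$⟩ g ⌉ i))

      -- A pair of equal elements instead of one point, because the two domains are different types.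
      Separates : ∀ i → A i × B i → Set ℓ
      Separates i (x , y) = x ∼ y × ¬ act f i x ∼ act g i y

      M-cong : ∀ {a b} → a ≡ b → ∀ i → M a i ≋ M b i
      M-cong refl i = ≋-refl

      separated : ∀ i → Represents f i (act f i) × Represents g i (act g i) →
                  ¬ mor f i Mors.≈ mor g i → Σ _ (Separates i)
      separated i (r , s) mor≉ = by-contradiction λ none → mor≉
        (Mors.trans (Mors.sym (equals r)) (Mors.trans (record
          { source-eq = M-cong dom-eq i
          ; target-eq = M-cong rng-eq i
          ; map-eq    = λ x y e → ≈-trans (≈-sym (agrees r x)) (≈-trans
              (by-contradiction (λ ¬e → none ((x , y) , e , ¬e))) (agrees s y))
          }) (equals s)))

      choice : ∀ i → Dec (Σ _ (Separates i)) → A i × B i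
      choice i (yes (xy , _)) = xy
      choice i (no _)         = nonempty (M _ i) , nonempty (M _ i)

      choice-spec : ∀ i (d : Dec (Σ _ (Separates i))) → Σ _ (Separates i) → Separates i (choice i d)
      choice-spec i (yes (_ , p)) _ = p
      choice-spec i (no ¬p)       p = contradiction p ¬p

  F₀ : Func (ElSetoid obs) (SmallModels U T)
  F₀ = record { to = λ a → object ⌈ a ⌉ ; cong = λ {a} {b} e → ultraproduct-cong (⌈⌉-cong {a} {b} e) }

  F₀-injective : ∀ {a b} → ultraproduct ⌈ a ⌉ ≋ ultraproduct ⌈ b ⌉ → a ∼ b
  F₀-injective {a} {b} e = ⌈⌉-injective {a} {b} (ultraproduct-injective {⌈ a ⌉} {⌈ b ⌉} e)

  embedding : Embedding C (Mod U T)
  embedding = record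
    { F₀           = F₀
    ; F₁           = record { to = F₁ ; cong = λ {f} {g} → F₁-cong {f} {g} }
    ; F-dom        = λ f → ≋-refl {M = ultraproduct ⌈ C.dom ⟨$⟩ f ⌉}
    ; F-rng        = λ f → ≋-refl {M = ultraproduct ⌈ C.rng ⟨$⟩ f ⌉}
    ; F-Id         = F₁-Id
    ; F-comp       = F₁-comp
    ; F₀-injective = λ {a} {b} → F₀-injective {a} {b}
    ; F₁-injective = λ {f} {g} → F₁-injective {f} {g}
    }

  strongEmbedding : (∀ f i → IsStrongMorphism U T (mor f i)) → Embedding C (ModStr U T)
  strongEmbedding h = record
    { F₀           = F₀
    ; F₁           = record { to = λ f → F₁ f , arrowHom-strong f (h f) ; cong = λ {f} {g} → F₁-cong {f} {g} }
    ; F-dom        = λ f → ≋-refl {M = ultraproduct ⌈ C.dom ⟨$⟩ f ⌉}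
    ; F-rng        = λ f → ≋-refl {M = ultraproduct ⌈ C.rng ⟨$⟩ f ⌉}
    ; F-Id         = F₁-Id
    ; F-comp       = F₁-comp
    ; F₀-injective = λ {a} {b} → F₀-injective {a} {b}
    ; F₁-injective = λ {f} {g} → F₁-injective {f} {g}
    }

theorem6p6 : (∀ {a} → ExcludedMiddle a) →
    (∀ {a b} → AxiomOfChoice a b) →
    ∀ {ℓ : Level} (U : V ℓ) → IsGrothendieckUniverse U →
    (L : Language ℓ) → L ∈ᴸ U → (T : Theory L) →
    ((C : SmallCategory U) → ElementarilyEquivalent (SmallCategory.category C) (Mod U T) → Embedding (SmallCategory.category C) (Mod U T))
    ×
    ((C : SmallCategory U) → ElementarilyEquivalent (SmallCategory.category C) (ModStr U T) → Embedding (SmallCategory.category C) (ModStr U T))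
theorem6p6 em ac U isU L _ T =
  (λ C equivalent →
    let open Compactness em ac isU C (Mod U T) equivalent
    in ModelEmbedding.embedding em ac isU T C ultrafilter name names∈U name∈names name-injective
         mor mor-spec) ,
  (λ C equivalent →
    let open Compactness em ac isU C (ModStr U T) equivalent
    in ModelEmbedding.strongEmbedding em ac isU T C ultrafilter name names∈U name∈names
         name-injective (λ f i → proj₁ (mor f i))
         -- For each fixed shape, `Holds` in `ModStr` unfolds to `Holds` in `Mod` on the underlying
         -- morphisms.
         (λ { equal → mor-spec equal ; identity → mor-spec identity
            ; composite → mor-spec composite })
         (λ f i → proj₂ (mor f i)))
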